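{- For every integer $d\geq 3$, let $\nu(d)$ denote the smallest number of vertices of a rigid $d$-regular graph. Then $$\nu(d)=\begin{cases}14 & \text{if } d=3,\\ 10 & \text{if } d=4,5,\\ 11 & \text{if } d=6,\\ 2\lceil d/2\rceil+4 & \text{if } d>6.\end{cases}$$
   Context: All graphs are finite, simple and undirected. A homomorphism between graphs is a map of vertex sets sending edges to edges; an endomorphism of $G$ is a homomorphism $G\to G$. A graph is rigid if its only endomorphism is the identity. -}

module Defs where

open import Data.Nat using (ℕ; zero; suc; _+_; _*_; _≤_; _<_)
open import Data.Nat.Base using (⌈_/2⌉)
open import Data.Bool using (Bool; true; false; if_then_else_)
open import Data.Fin using (Fin)
open import Data.List using (List; length; filterᵇ)
open import Data.List.Base using (allFin)
open import Data.Product using (Σ; _×_; _,_)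
open import Relation.Binary.PropositionalEquality using (_≡_)
open import Relation.Nullary using (¬_)

record Graph (n : ℕ) : Set where
  field
    adj       : Fin n → Fin n → Bool
    symmetric : ∀ u v → adj u v ≡ adj v u
    irreflex  : ∀ v → adj v v ≡ false
open Graph public

degree : ∀ {n} → Graph n → Fin n → ℕ
degree G v = length (filterᵇ (adj G v) (allFin _))

Regular : ∀ {n} → ℕ → Graph n → Set
Regular d G = ∀ v → degree G v ≡ d

IsEndomorphism : ∀ {n} → Graph n → (Fin n → Fin n) → Set
IsEndomorphism G f = ∀ u v → adj G u v ≡ true → adj G (f u) (f v) ≡ true

Rigid : ∀ {n} → Graph n → Set
Rigid G = ∀ f → IsEndomorphism G f → ∀ v → f v ≡ v

-- "there is a rigid d-regular graph on n vertices"
-- graphs are required to have a nonempty vertex set (n ≥ 1); otherwise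
-- the empty graph would vacuously be a rigid d-regular graph
HasRigidRegular : ℕ → ℕ → Set
HasRigidRegular d n = 1 ≤ n × Σ (Graph n) (λ G → Regular d G × Rigid G)

IsNu : ℕ → ℕ → Set
IsNu d m = HasRigidRegular d m × (∀ n → n < m → ¬ HasRigidRegular d n)

nuValue : ℕ → ℕ
nuValue 3 = 14
nuValue 4 = 10
nuValue 5 = 10
nuValue 6 = 11
nuValue d = 2 * ⌈ d /2⌉ + 4

{-# OPTIONS --safe #-}

-- Lower bounds. The complement of a d-regular graph on d + 1 + r vertices is r-regular, and for r ≤ 2
-- it has a non-trivial automorphism; parity excludes further orders. The remaining small orders are
-- settled by enumerating all cubic graphs on 8, 10 and 12 vertices and all 4-regular graphs on 9
-- vertices, up to relabelling.
--
-- Upper bounds. Let H be regular, triangle-free and connected, with an odd cycle, and let f be an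
-- endomorphism of its complement. The preimage of an edge x y of H is a clique of H, so
-- |f⁻¹(x)| + |f⁻¹(y)| ≤ 2. Summed over all edges this is an equality, hence |f⁻¹(x)| + |f⁻¹(y)| = 2 on every
-- edge, and the odd cycle forces all fibres to be singletons. So f is an automorphism, and the complement
-- is rigid as soon as H is asymmetric. For large d such cubic and 4-regular graphs H are obtained by
-- closing up a long strip with a fixed asymmetric gadget.
module Submission where

open import Defs
open import Data.Nat hiding (_≟_)
open import Data.Nat.Properties hiding (_≟_)
open import Algebra.Properties.CommutativeMonoid.Sum +-0-commutativeMonoid
  using (sum; sum-cong-≗; ∑-distrib-+; ∑-comm; ∑-permute)
open import Data.Bool using (Bool; true; false; T; not; _∧_; _∨_; if_then_else_)
import Data.Bool as Bool
import Data.Nat as ℕ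
import Data.Empty.Irrelevant as Irrelevant
open import Data.Empty using (⊥; ⊥-elim)
open import Data.Fin using (Fin; zero; suc; toℕ; fromℕ<; punchOut; _↑ˡ_; _↑ʳ_; splitAt; combine; remQuot)
import Data.Fin as Fin
open import Data.Fin.Patterns
open import Data.Fin.Permutation using (Permutation; _⟨$⟩ʳ_; permutation)
open import Data.Fin.Permutation.Components using (transpose; transpose-inverse)
import Data.Fin.Properties as Fin
open import Data.List using (List; []; _∷_; _++_; length; filter; filterᵇ)
import Data.List as List
open import Data.List.Membership.Propositional using (_∈_; _∉_)
open import Data.List.Membership.Propositional.Properties
  using (∈-∃++; ∈-++⁻; ∈-++⁺ˡ; ∈-++⁺ʳ; ∈-filter⁺; ∈-allFin)
open import Data.List.Properties using (length-++; length-map)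
open import Data.List.Relation.Unary.All using (All; []; _∷_)
import Data.List.Relation.Unary.All as All
import Data.List.Relation.Unary.All.Properties as All
open import Data.List.Relation.Unary.AllPairs using ([]; _∷_)
open import Data.List.Relation.Unary.Any using (here; there; any?)
open import Data.List.Relation.Unary.Unique.Propositional using (Unique)
import Data.List.Relation.Unary.Unique.Propositional.Properties as Unique
open import Data.Parity.Base using (0ℙ; 1ℙ) renaming (_*_ to _*ℙ_)
open import Data.Parity.Properties using (p+p≡0ℙ) renaming (+-homo-+ to parity-+; *-homo-* to parity-*)
open import Data.Product using (∃; ∃₂; _×_; _,_; proj₁; proj₂; uncurry)
open import Data.Sum using (_⊎_; inj₁; inj₂; [_,_]′)
open import Data.Vec using (Vec; []; _∷_; lookup; tabulate; replicate; zipWith; toList)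
import Data.Vec as Vec
open import Data.Vec.Properties using (lookup∘tabulate; tabulate∘lookup; tabulate-cong; lookup-replicate; lookup-map)
open import Function using (_∘_; id; case_of_)
open import Relation.Binary.Definitions using (DecidableEquality)
open import Relation.Binary.PropositionalEquality
open import Relation.Nullary using (¬_; Dec; yes; no; does; contradiction)
open import Relation.Nullary.Decidable using (dec-true; dec-false; map′; _×-dec_; recompute)

-- The complement of a d-regular graph on n vertices has degree n - d - 1, and this has to be at
-- least 3. Odd-regular graphs have even order, so the first candidate is a cubic complement on d +
-- 4 vertices for even d and a 4-regular complement on d + 5 vertices for odd d; in both cases the
-- order is 2⌈d/2⌉ + 4. Only d = 3, 4, 6 miss this value, since 8 and 10 vertices are too few for an
-- asymmetric cubic graph.
--
-- The obstacle in the upper bounds is to prove asymmetry for graphs of unbounded order, whereas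
-- evaluation settles one finite configuration. A local invariant bridges the gap. In degree k + 1,
-- call a vertex twinless if no other vertex shares k neighbours with it. Strips consist of vertices
-- with twins, and the gadget contributes a handful of twinless ones. An automorphism permutes
-- these, hence also the vertices in their closed neighbourhood; a finite check shows that it fixes
-- all of them. Fixedness then spreads along the strip, because each next vertex is the only
-- neighbour of a fixed vertex not yet known to be fixed. The finite checks evaluate with the length
-- of the strip left as a variable.

private
  variable
    n m k d g t : ℕ

-- Counting

Inj : (Fin m → Fin n) → Set
Inj f = ∀ u v → f u ≡ f v → u ≡ v

bit : Bool → ℕ
bit b = if b then 1 else 0

-- With cardinalities as sums of bits, double counting and reindexing become `∑-comm` and
-- `∑-permute`.
count : (Fin n → Bool) → ℕ
count p = sum (bit ∘ p)

length-filterᵇ-tabulate : ∀ {A : Set} (p : A → Bool) (g : Fin n → A) →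
  length (filterᵇ p (List.tabulate g)) ≡ count (p ∘ g)
length-filterᵇ-tabulate {zero}  p g = refl
length-filterᵇ-tabulate {suc n} p g with p (g zero)
... | true  = cong suc (length-filterᵇ-tabulate p (g ∘ suc))
... | false = length-filterᵇ-tabulate p (g ∘ suc)

degree≡count : (G : Graph n) (v : Fin n) → degree G v ≡ count (adj G v)
degree≡count G v = length-filterᵇ-tabulate (adj G v) id

sum-const : ∀ n c → sum {n} (λ _ → c) ≡ n * c
sum-const zero    c = refl
sum-const (suc n) c = cong (c +_) (sum-const n c)

sum-*ʳ : (t : Fin n → ℕ) (c : ℕ) → sum (λ i → t i * c) ≡ sum t * c
sum-*ʳ {zero}  t c = refl
sum-*ʳ {suc n} t c = trans (cong (t zero * c +_) (sum-*ʳ (t ∘ suc) c)) (sym (*-distribʳ-+ c (t zero) (sum (t ∘ suc))))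

sum-mono-≤ : {s t : Fin n → ℕ} → (∀ i → s i ≤ t i) → sum s ≤ sum t
sum-mono-≤ {zero}  h = z≤n
sum-mono-≤ {suc n} h = +-mono-≤ (h zero) (sum-mono-≤ (h ∘ suc))

≤∧sum-≡⇒≗ : {s t : Fin n → ℕ} → (∀ i → s i ≤ t i) → sum s ≡ sum t → ∀ i → s i ≡ t i
≤∧sum-≡⇒≗ {suc n} {s} {t} h e = λ { zero → head≡ ; (suc i) → ≤∧sum-≡⇒≗ (h ∘ suc) tail≡ i }
  where
  open ≤-Reasoning
  t₀≤s₀ : t zero ≤ s zero
  t₀≤s₀ = +-cancelʳ-≤ (sum (t ∘ suc)) _ _ (begin
    t zero + sum (t ∘ suc) ≡⟨ sym e ⟩
    s zero + sum (s ∘ suc) ≤⟨ +-monoʳ-≤ (s zero) (sum-mono-≤ (h ∘ suc)) ⟩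
    s zero + sum (t ∘ suc) ∎)
  head≡ : s zero ≡ t zero
  head≡ = ≤-antisym (h zero) t₀≤s₀
  tail≡ : sum (s ∘ suc) ≡ sum (t ∘ suc)
  tail≡ = +-cancelˡ-≡ (t zero) _ _ (trans (cong (_+ _) (sym head≡)) e)

count-cong : {p q : Fin n → Bool} → (∀ i → p i ≡ q i) → count p ≡ count q
count-cong h = sum-cong-≗ (λ i → cong bit (h i))

bit-mono : ∀ {a b} → (a ≡ true → b ≡ true) → bit a ≤ bit b
bit-mono {false} h = z≤n
bit-mono {true}  h rewrite h refl = ≤-refl

bit-injective : ∀ {a b} → bit a ≡ bit b → a ≡ b
bit-injective {false} {false} e = refl
bit-injective {true}  {true}  e = refl

⊆∧count-≡⇒≗ : {p q : Fin n → Bool} → (∀ i → p i ≡ true → q i ≡ true) → count p ≡ count q →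
  ∀ i → p i ≡ q i
⊆∧count-≡⇒≗ {p = p} {q} h e i = bit-injective (≤∧sum-≡⇒≗ {s = bit ∘ p} {bit ∘ q} (λ j → bit-mono (h j)) e i)

count-false : {p : Fin n → Bool} → (∀ i → p i ≡ false) → count p ≡ 0
count-false {n} h = trans (count-cong h) (trans (sum-const n 0) (*-zeroʳ n))

count-∃ : (p : Fin n → Bool) → 1 ≤ count p → ∃ λ u → p u ≡ true
count-∃ {suc n} p h with p zero in eq
... | true  = zero , eq
... | false with count-∃ (p ∘ suc) h
...   | u , pu = suc u , pu

count-∃₂ : (p : Fin n → Bool) → 2 ≤ count p → ∃₂ λ u v → u ≢ v × p u ≡ true × p v ≡ true
count-∃₂ {suc n} p h with p zero in eq
... | true  with count-∃ (p ∘ suc) (s≤s⁻¹ h)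
...   | u , pu = zero , suc u , (λ ()) , eq , pu
count-∃₂ {suc n} p h | false with count-∃₂ (p ∘ suc) h
...   | u , v , u≢v , pu , pv = suc u , suc v , u≢v ∘ Fin.suc-injective , pu , pv

count-∃₃ : (p : Fin n → Bool) → 3 ≤ count p →
  ∃₂ λ u v → ∃ λ w → (u ≢ v × v ≢ w × u ≢ w) × (p u ≡ true × p v ≡ true × p w ≡ true)
count-∃₃ {suc n} p h with p zero in eq
... | true  with count-∃₂ (p ∘ suc) (s≤s⁻¹ h)
...   | u , v , u≢v , pu , pv =
  zero , suc u , suc v , ((λ ()) , u≢v ∘ Fin.suc-injective , (λ ())) , (eq , pu , pv)
count-∃₃ {suc n} p h | false with count-∃₃ (p ∘ suc) h
...   | u , v , w , (a , b , c) , (pu , pv , pw) =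
  suc u , suc v , suc w ,
  (a ∘ Fin.suc-injective , b ∘ Fin.suc-injective , c ∘ Fin.suc-injective) , (pu , pv , pw)

_==_ : Fin n → Fin n → Bool
u == v = does (u Fin.≟ v)

==-refl : (u : Fin n) → (u == u) ≡ true
==-refl u = dec-true (u Fin.≟ u) refl

==-≢ : {u v : Fin n} → u ≢ v → (u == v) ≡ false
==-≢ {u = u} {v} h = dec-false (u Fin.≟ v) h

==⇒≡ : (u v : Fin n) → (u == v) ≡ true → u ≡ v
==⇒≡ u v h with u Fin.≟ v
... | yes e = e

count-== : (x : Fin n) → count (_== x) ≡ 1
count-== {suc n} zero    = cong suc (count-false {n} (λ i → refl))
count-== {suc n} (suc x) = count-== x

count-1≤ : (p : Fin n → Bool) (u : Fin n) → p u ≡ true → 1 ≤ count p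
count-1≤ p u pu = subst (_≤ count p) (count-== u)
  (sum-mono-≤ (λ i → bit-mono {i == u} {p i} (λ e → trans (cong p (==⇒≡ i u e)) pu)))

count-2≤ : (p : Fin n → Bool) (u v : Fin n) → u ≢ v → p u ≡ true → p v ≡ true → 2 ≤ count p
count-2≤ p u v u≢v pu pv = begin
  2                                      ≡⟨ sym (cong₂ _+_ (count-== u) (count-== v)) ⟩
  count (_== u) + count (_== v)          ≡⟨ sym (∑-distrib-+ (bit ∘ (_== u)) (bit ∘ (_== v))) ⟩
  sum (λ i → bit (i == u) + bit (i == v)) ≤⟨ sum-mono-≤ le ⟩
  count p                                ∎
  where
  open ≤-Reasoning
  le : ∀ i → bit (i == u) + bit (i == v) ≤ bit (p i)
  le i with i Fin.≟ u
  ... | yes refl rewrite ==-≢ u≢v | pu = ≤-refl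
  ... | no _ with i Fin.≟ v
  ...   | yes refl rewrite pv = ≤-refl
  ...   | no _ = z≤n

injective⇒surjective : {f : Fin n → Fin n} → Inj f → ∀ y → ∃ λ x → f x ≡ y
injective⇒surjective {suc n} {f} inj y with Fin.any? (λ x → f x Fin.≟ y)
... | yes p = p
... | no ¬p = contradiction
  (Fin.injective⇒≤ {f = λ x → punchOut (y≢f x)} (λ {u} {v} e → inj u v (Fin.punchOut-injective (y≢f u) (y≢f v) e)))
  1+n≰n
  where
  y≢f : ∀ x → y ≢ f x
  y≢f x e = ¬p (x , sym e)

injective⇒permutation : {f : Fin n → Fin n} → Inj f → ∃ λ (π : Permutation n n) → ∀ x → π ⟨$⟩ʳ x ≡ f x
injective⇒permutation {f = f} inj =
  permutation f (proj₁ ∘ surj) (proj₂ ∘ surj) (λ x → inj _ _ (proj₂ (surj (f x)))) ,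
  λ _ → refl
  where surj = injective⇒surjective inj

count-reindex : (f : Fin n → Fin n) → Inj f → (p : Fin n → Bool) → count (p ∘ f) ≡ count p
count-reindex f inj p with injective⇒permutation inj
... | π , eq = trans (count-cong (λ i → cong p (sym (eq i)))) (sym (∑-permute (bit ∘ p) π))

transpose-inj : (i j : Fin m) → Inj (transpose i j)
transpose-inj i j u v e = trans (sym (transpose-inverse j i)) (trans (cong (transpose j i) e) (transpose-inverse j i))

-- Complements

true≢false : true ≢ false
true≢false ()

¬true : ∀ {b} → b ≢ true → b ≡ false
¬true {false} h = refl
¬true {true}  h = contradiction refl h

count-degree : (G : Graph n) → Regular d G → ∀ v → count (adj G v) ≡ d
count-degree G reg v = trans (sym (degree≡count G v)) (reg v)

adj⇒≢ : (G : Graph n) {u v : Fin n} → adj G u v ≡ true → u ≢ v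
adj⇒≢ G {u} uv refl = true≢false (trans (sym uv) (irreflex G u))

-- The neighbourhood of `u` is contained in the preimage of the neighbourhood of `f u`. Both have
-- `d` elements, so they coincide.
injective-endo-reflects : (G : Graph n) → Regular d G → (f : Fin n → Fin n) → Inj f → IsEndomorphism G f →
  ∀ u v → adj G (f u) (f v) ≡ adj G u v
injective-endo-reflects G reg f inj endo u v = sym (⊆∧count-≡⇒≗ {p = adj G u} {q = adj G (f u) ∘ f} (endo u)
  (trans (count-degree G reg u)
         (sym (trans (count-reindex f inj (adj G (f u))) (count-degree G reg (f u))))) v)

complement : Graph n → Graph n
complement H .adj u v = not (u == v) ∧ not (adj H u v)
complement H .symmetric u v with u Fin.≟ v | v Fin.≟ u
... | yes _ | yes _ = refl
... | yes e | no ¬e = contradiction (sym e) ¬e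
... | no ¬e | yes e = contradiction (sym e) ¬e
... | no _  | no _  = cong not (symmetric H u v)
complement H .irreflex v rewrite ==-refl v = refl

complement-intro : (H : Graph n) {u v : Fin n} → u ≢ v → adj H u v ≡ false → adj (complement H) u v ≡ true
complement-intro H u≢v h rewrite ==-≢ u≢v | h = refl

complement-elim : (H : Graph n) {u v : Fin n} → adj (complement H) u v ≡ true → u ≢ v × adj H u v ≡ false
complement-elim H {u} {v} h with u Fin.≟ v | adj H u v
... | no ¬e | false = ¬e , refl

complement-degree : (H : Graph n) (v : Fin n) → suc (count (adj H v) + count (adj (complement H) v)) ≡ n
complement-degree {n} H v = begin
  1 + (count (adj H v) + count (adj (complement H) v))
    ≡⟨ cong₂ _+_ (sym (count-== v)) (sym (∑-distrib-+ (bit ∘ adj H v) (bit ∘ adj (complement H) v))) ⟩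
  count (_== v) + sum (λ u → bit (adj H v u) + bit (adj (complement H) v u))
    ≡⟨ sym (∑-distrib-+ (bit ∘ (_== v)) (λ u → bit (adj H v u) + bit (adj (complement H) v u))) ⟩
  sum (λ u → bit (u == v) + (bit (adj H v u) + bit (adj (complement H) v u)))
    ≡⟨ sum-cong-≗ one ⟩
  sum {n} (λ _ → 1)
    ≡⟨ trans (sum-const n 1) (*-identityʳ n) ⟩
  n ∎
  where
  open ≡-Reasoning
  one : ∀ u → bit (u == v) + (bit (adj H v u) + bit (adj (complement H) v u)) ≡ 1
  one u with u Fin.≟ v
  ... | yes refl rewrite ==-refl u | irreflex H u = refl
  ... | no u≢v rewrite ==-≢ (u≢v ∘ sym) with adj H v u
  ...   | true  = refl
  ...   | false = refl

complement-regular : (H : Graph n) → Regular k H → suc (k + d) ≡ n → Regular d (complement H)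
complement-regular {n} {k} {d} H reg e v = trans (degree≡count (complement H) v)
  (+-cancelˡ-≡ k _ _ (suc-injective (begin
    suc (k + count (adj (complement H) v))                    ≡⟨ cong (λ x → suc (x + count (adj (complement H) v))) (sym (count-degree H reg v)) ⟩
    suc (count (adj H v) + count (adj (complement H) v))      ≡⟨ complement-degree H v ⟩
    n                                                         ≡⟨ sym e ⟩
    suc (k + d) ∎)))
  where open ≡-Reasoning

degree<n : (G : Graph n) → Regular d G → 1 ≤ n → d < n
degree<n {suc n} {d} G reg _ = s≤s (≤-trans (≤-reflexive (sym (count-degree G reg zero)))
  (subst (count (adj G zero) ≤_) (suc-injective (complement-degree G zero)) (m≤m+n _ _)))

-- An injective endomorphism of the regular graph `complement G` reflects edges, hence preserves the
-- edges of `G`. Symmetries can therefore be constructed in the sparser complement.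
automorphism⇒¬Rigid : (G : Graph n) → Regular d G → (f : Fin n → Fin n) → Inj f →
  IsEndomorphism (complement G) f → (∃ λ v → f v ≢ v) → ¬ Rigid G
automorphism⇒¬Rigid {n} {d} G reg f inj endo (v , fv≢v) rigid = fv≢v (rigid f endoG v)
  where
  G′ = complement G
  reg′ : Regular (n ∸ suc d) G′
  reg′ = complement-regular G reg (m+[n∸m]≡n (degree<n G reg (≤-trans (s≤s z≤n) (Fin.toℕ<n v))))
  endoG : IsEndomorphism G f
  endoG u w uw with adj G (f u) (f w) in eq
  ... | true  = refl
  ... | false = contradiction (trans (sym uw) (proj₂ (complement-elim G (trans (sym (injective-endo-reflects G′ reg′ f inj endo u w))
      (complement-intro G (adj⇒≢ G uw ∘ inj u w) eq))))) true≢false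

TriangleFree : Graph n → Set
TriangleFree H = ∀ u v w → adj H u v ≡ true → adj H v w ≡ true → adj H u w ≡ true → ⊥

-- For a connected graph this says that there is an odd cycle.
Unbalanced : Graph n → Set
Unbalanced {n} H = (c : Fin n → ℕ) → (∀ u v → adj H u v ≡ true → c u + c v ≡ 2) → ∀ v → c v ≡ 1

Asymmetric : Graph n → Set
Asymmetric H = ∀ f → Inj f → IsEndomorphism H f → ∀ v → f v ≡ v

module _ (H : Graph n) (reg : Regular k H) (triangleFree : TriangleFree H)
         (f : Fin n → Fin n) (endo : IsEndomorphism (complement H) f) where

  private
    G : Graph n
    G = complement H

    a : Fin n → Fin n → ℕ
    a u v = bit (adj H u v)

    fibre : Fin n → ℕ
    fibre x = count (λ u → f u == x)

    -- Contraposition: distinct non-neighbours in `H` are adjacent in `G`, so their images are again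
    -- distinct non-neighbours in `H`.
    close : ∀ {u v} → u ≢ v → f u ≡ f v ⊎ adj H (f u) (f v) ≡ true → adj H u v ≡ true
    close {u} {v} u≢v h with adj H u v in eq
    ... | true  = refl
    ... | false with complement-elim H (endo u v (complement-intro H u≢v eq)) | h
    ...   | fu≢fv , _ | inj₁ e = contradiction e fu≢fv
    ...   | _ , fe    | inj₂ e = contradiction (trans (sym e) fe) true≢false

    -- The preimage of an edge is a clique.
    fibre-edge : ∀ x y → adj H x y ≡ true → fibre x + fibre y ≤ 2
    fibre-edge x y xy = subst (_≤ 2) split (≮⇒≥ λ three → absurd (count-∃₃ p three))
      where
      p : Fin n → Bool
      p u = (f u == x) ∨ (f u == y)
      split : count p ≡ fibre x + fibre y
      split = trans (sum-cong-≗ eq) (∑-distrib-+ (λ u → bit (f u == x)) (λ u → bit (f u == y)))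
        where
        eq : ∀ u → bit (p u) ≡ bit (f u == x) + bit (f u == y)
        eq u with f u Fin.≟ x
        ... | no _     = refl
        ... | yes refl = cong suc (cong bit (sym (==-≢ (adj⇒≢ H xy))))
      cases : ∀ u → p u ≡ true → f u ≡ x ⊎ f u ≡ y
      cases u h with f u == x in e | f u == y in e′
      ... | true  | _    = inj₁ (==⇒≡ _ _ e)
      ... | false | true = inj₂ (==⇒≡ _ _ e′)
      near : ∀ u v → p u ≡ true → p v ≡ true → f u ≡ f v ⊎ adj H (f u) (f v) ≡ true
      near u v pu pv with cases u pu | cases v pv
      ... | inj₁ e | inj₁ e′ = inj₁ (trans e (sym e′))
      ... | inj₁ e | inj₂ e′ = inj₂ (trans (cong₂ (adj H) e e′) xy)
      ... | inj₂ e | inj₁ e′ = inj₂ (trans (cong₂ (adj H) e e′) (trans (symmetric H y x) xy))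
      ... | inj₂ e | inj₂ e′ = inj₁ (trans e (sym e′))
      absurd : (∃₂ λ u v → ∃ λ w → (u ≢ v × v ≢ w × u ≢ w) × (p u ≡ true × p v ≡ true × p w ≡ true)) → ⊥
      absurd (u , v , w , (u≢v , v≢w , u≢w) , (pu , pv , pw)) = triangleFree u v w
        (close u≢v (near u v pu pv)) (close v≢w (near v w pv pw)) (close u≢w (near u w pu pw))

    fibre-total : sum fibre ≡ n
    fibre-total = begin
      sum (λ x → sum (λ u → bit (f u == x))) ≡⟨ ∑-comm (λ x u → bit (f u == x)) ⟩
      sum (λ u → sum (λ x → bit (f u == x))) ≡⟨ sum-cong-≗ (λ u → trans (sum-cong-≗ (λ x → cong bit (==-sym (f u) x))) (count-== (f u))) ⟩
      sum {n} (λ _ → 1)                      ≡⟨ trans (sum-const n 1) (*-identityʳ n) ⟩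
      n ∎
      where
      open ≡-Reasoning
      ==-sym : ∀ (u v : Fin n) → (u == v) ≡ (v == u)
      ==-sym u v with u Fin.≟ v
      ... | yes refl = sym (==-refl u)
      ... | no h     = sym (==-≢ (h ∘ sym))

    rows : (w : Fin n → ℕ) → sum (λ x → sum (λ y → a x y * w x)) ≡ sum w * k
    rows w = trans (sum-cong-≗ row) (sum-*ʳ w k)
      where
      row : ∀ x → sum (λ y → a x y * w x) ≡ w x * k
      row x = trans (sum-*ʳ (a x) (w x)) (trans (cong (_* w x) (count-degree H reg x)) (*-comm k (w x)))

    -- Both sides equal 2nk: on the left every fibre size is counted `k` times as the first and `k`
    -- times as the second end of an edge, and the sizes add up to `n`.
    total : sum (λ x → sum (λ y → a x y * (fibre x + fibre y))) ≡ sum (λ x → sum (λ y → a x y * 2))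
    total = begin
      sum (λ x → sum (λ y → a x y * (fibre x + fibre y)))
        ≡⟨ sum-cong-≗ (λ x → trans (sum-cong-≗ (λ y → *-distribˡ-+ (a x y) (fibre x) (fibre y))) (∑-distrib-+ (λ y → a x y * fibre x) (λ y → a x y * fibre y))) ⟩
      sum (λ x → sum (λ y → a x y * fibre x) + sum (λ y → a x y * fibre y))
        ≡⟨ ∑-distrib-+ (λ x → sum (λ y → a x y * fibre x)) (λ x → sum (λ y → a x y * fibre y)) ⟩
      sum (λ x → sum (λ y → a x y * fibre x)) + sum (λ x → sum (λ y → a x y * fibre y))
        ≡⟨ cong₂ _+_ (rows fibre) (trans (∑-comm (λ x y → a x y * fibre y)) (trans (sum-cong-≗ (λ y → sum-cong-≗ (λ x → cong (λ b → bit b * fibre y) (symmetric H x y)))) (rows fibre))) ⟩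
      sum fibre * k + sum fibre * k
        ≡⟨ cong (λ s → s * k + s * k) fibre-total ⟩
      n * k + n * k
        ≡⟨ sym (*-distribʳ-+ k n n) ⟩
      (n + n) * k
        ≡⟨ cong (_* k) (trans (cong (n +_) (sym (+-identityʳ n))) (*-comm 2 n)) ⟩
      n * 2 * k
        ≡⟨ cong (_* k) (sym (sum-const n 2)) ⟩
      sum {n} (λ _ → 2) * k
        ≡⟨ sym (rows (λ _ → 2)) ⟩
      sum (λ x → sum (λ y → a x y * 2)) ∎
      where open ≡-Reasoning

    pointwise≤ : ∀ x y → a x y * (fibre x + fibre y) ≤ a x y * 2
    pointwise≤ x y with adj H x y in eq
    ... | true  = +-monoˡ-≤ 0 (fibre-edge x y eq)
    ... | false = z≤n

  fibre-sum : ∀ x y → adj H x y ≡ true → fibre x + fibre y ≡ 2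
  -- Equality of the double sums passes to each row and then to each entry. The cancelled 0 comes
  -- from `1 * t`, which reduces to `t + 0`.
  fibre-sum x y xy = +-cancelʳ-≡ 0 _ _ (subst (λ b → bit b * (fibre x + fibre y) ≡ bit b * 2) xy
    (≤∧sum-≡⇒≗ (pointwise≤ x) (≤∧sum-≡⇒≗ (λ x′ → sum-mono-≤ (pointwise≤ x′)) total x) y))

  unbalanced⇒injective : Unbalanced H → Inj f
  unbalanced⇒injective unb u v e with u Fin.≟ v
  ... | yes u≡v = u≡v
  ... | no u≢v  = contradiction (unb fibre fibre-sum (f u))
    (λ one → 1+n≰n (≤-trans (count-2≤ (λ w → f w == f u) u v u≢v (==-refl (f u)) (trans (cong (_== f u) (sym e)) (==-refl (f u)))) (≤-reflexive one)))

complement-rigid : (H : Graph n) → Regular k H → TriangleFree H → Unbalanced H → Asymmetric H →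
  Rigid (complement H)
complement-rigid {n} {k} H reg tf unb asym f endo = asym f inj endoH
  where
  inj : Inj f
  inj = unbalanced⇒injective H reg tf f endo unb
  endoH : IsEndomorphism H f
  endoH u v uv with adj H (f u) (f v) in eq
  ... | true  = refl
  ... | false = contradiction (trans (sym (injective-endo-reflects (complement H)
      (complement-regular H reg (m+[n∸m]≡n (degree<n H reg (≤-trans (s≤s z≤n) (Fin.toℕ<n u))))) f inj endo u v))
      (complement-intro H (adj⇒≢ H uv ∘ inj u v) eq)) (λ e → contradiction (trans (sym uv) (proj₂ (complement-elim H e))) true≢false)

-- Backtracking search

∧-elim : ∀ {a b} → (a ∧ b) ≡ true → a ≡ true × b ≡ true
∧-elim {true} h = refl , h

not-true : ∀ {b} → not b ≡ true → b ≡ false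
not-true {false} _ = refl

does-true : {A : Set} (a? : Dec A) → does a? ≡ true → A
does-true (yes a) _ = a

infixr 4 _⇒ᵇ_
_⇒ᵇ_ : Bool → Bool → Bool
true  ⇒ᵇ b = b
false ⇒ᵇ b = true

⇒ᵇ-elim : ∀ {a b} → (a ⇒ᵇ b) ≡ true → a ≡ true → b ≡ true
⇒ᵇ-elim {true} h _ = h

⇒ᵇ-intro : ∀ {a b} → (a ≡ true → b ≡ true) → (a ⇒ᵇ b) ≡ true
⇒ᵇ-intro {true}  h = h refl
⇒ᵇ-intro {false} h = refl

allᵇ : (Fin n → Bool) → Bool
allᵇ {zero}  p = true
allᵇ {suc n} p = p zero ∧ allᵇ (p ∘ suc)

allᵇ-elim : {p : Fin n → Bool} → allᵇ p ≡ true → ∀ i → p i ≡ true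
allᵇ-elim h zero    = proj₁ (∧-elim h)
allᵇ-elim h (suc i) = allᵇ-elim (proj₂ (∧-elim h)) i

-- A search under a binary constraint. One soundness proof serves endomorphisms, injective
-- endomorphisms, fibre sizes and maps of a gadget core.
module _ (compatible : Fin n → Fin k → Fin n → Fin k → Bool) (target : Fin n → Fin k) where

  fits : Fin n → Fin k → List (Fin n × Fin k) → Bool
  fits i c []               = true
  fits i c ((j , e) ∷ done) = compatible i c j e ∧ fits i c done

  agrees : List (Fin n × Fin k) → Bool
  agrees []               = true
  agrees ((i , c) ∷ done) = (c == target i) ∧ agrees done

  -- If this evaluates to `true`, every compatible completion of the partial map `done` agrees with
  -- `target`. The implication cuts off a branch at its first conflict.
  explore : List (Fin n) → List (Fin n × Fin k) → Bool
  explore []         done = agrees done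
  explore (i ∷ todo) done = allᵇ λ c → (compatible i c i c ∧ fits i c done) ⇒ᵇ explore todo ((i , c) ∷ done)

  module _ (f : Fin n → Fin k) (f-compatible : ∀ i j → compatible i (f i) j (f j) ≡ true) where

    fits-f : ∀ i {done} → All (λ (j , e) → f j ≡ e) done → fits i (f i) done ≡ true
    fits-f i []                            = refl
    fits-f i (_∷_ {x = j , e} refl onGraph) rewrite f-compatible i j = fits-f i onGraph

    agrees-elim : ∀ {done} → All (λ (j , e) → f j ≡ e) done → agrees done ≡ true →
      ∀ {i} → (i , f i) ∈ done → f i ≡ target i
    agrees-elim (_ ∷ _)       h (here refl) = ==⇒≡ _ _ (proj₁ (∧-elim h))
    agrees-elim (_ ∷ onGraph) h (there p)   = agrees-elim onGraph (proj₂ (∧-elim h)) p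

    -- Agreement is tested at the leaves only, so an assignment is followed inside `done` down the
    -- one branch that `f` describes.
    explore-done : ∀ todo {done} → All (λ (j , e) → f j ≡ e) done → explore todo done ≡ true →
      ∀ {i} → (i , f i) ∈ done → f i ≡ target i
    explore-todo : ∀ todo {done} → All (λ (j , e) → f j ≡ e) done → explore todo done ≡ true →
      ∀ {i} → i ∈ todo → f i ≡ target i

    step : ∀ i todo {done} → All (λ (j , e) → f j ≡ e) done → explore (i ∷ todo) done ≡ true →
      explore todo ((i , f i) ∷ done) ≡ true
    step i todo onGraph h = ⇒ᵇ-elim (allᵇ-elim h (f i)) (cong₂ _∧_ (f-compatible i i) (fits-f i onGraph))

    explore-done []         onGraph h p = agrees-elim onGraph h p
    explore-done (i ∷ todo) onGraph h p = explore-done todo (refl ∷ onGraph) (step i todo onGraph h) (there p)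

    explore-todo (i ∷ todo) onGraph h (here refl) = explore-done todo (refl ∷ onGraph) (step i todo onGraph h) (here refl)
    explore-todo (i ∷ todo) onGraph h (there p)   = explore-todo todo (refl ∷ onGraph) (step i todo onGraph h) p

  forced : Bool
  forced = explore (List.allFin n) []

  forced-sound : forced ≡ true → ∀ f → (∀ i j → compatible i (f i) j (f j) ≡ true) → ∀ i → f i ≡ target i
  forced-sound h f f-compatible i = explore-todo f f-compatible _ [] h (∈-allFin i)

_∈ᵇ_ : ℕ → List ℕ → Bool
x ∈ᵇ []       = false
x ∈ᵇ (y ∷ ys) = (x ≡ᵇ y) ∨ (x ∈ᵇ ys)

module _ (neighbours : Vec (List ℕ) n) where

  tableAdj : Fin n → Fin n → Bool
  tableAdj u v = toℕ v ∈ᵇ lookup neighbours u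

  isGraph : Bool
  isGraph = allᵇ λ u → not (tableAdj u u) ∧ allᵇ λ v → does (tableAdj u v Bool.≟ tableAdj v u)

  isRegular : ℕ → Bool
  isRegular d = allᵇ λ u → count (tableAdj u) ≡ᵇ d

  tableGraph : isGraph ≡ true → Graph n
  tableGraph h .adj = tableAdj
  tableGraph h .symmetric u v = does-true (tableAdj u v Bool.≟ tableAdj v u) (allᵇ-elim (proj₂ (∧-elim {not (tableAdj u u)} (allᵇ-elim h u))) v)
  tableGraph h .irreflex v = not-true (proj₁ (∧-elim {not (tableAdj v v)} (allᵇ-elim h v)))

  table-regular : (h : isGraph ≡ true) → isRegular d ≡ true → Regular d (tableGraph h)
  table-regular h r v = trans (degree≡count (tableGraph h) v) (≡ᵇ⇒≡ _ _ (subst T (sym (allᵇ-elim r v)) _))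

preserves : (Fin n → Fin n → Bool) → Fin n → Fin n → Fin n → Fin n → Bool
preserves a i c j e = a i j ⇒ᵇ a c e

preserves-distinct : (Fin n → Fin n → Bool) → Fin n → Fin n → Fin n → Fin n → Bool
preserves-distinct a i c j e = ((c == e) ⇒ᵇ (i == j)) ∧ (a i j ⇒ᵇ a c e)

rigid-by-search : (G : Graph n) → forced (preserves (adj G)) id ≡ true → Rigid G
rigid-by-search G h f endo = forced-sound _ id h f (λ i j → ⇒ᵇ-intro (endo i j))

asymmetric-by-search : (G : Graph n) → forced (preserves-distinct (adj G)) id ≡ true → Asymmetric G
asymmetric-by-search G h f inj endo = forced-sound _ id h f λ i j →
  cong₂ _∧_ (⇒ᵇ-intro (λ e → trans (cong (_== j) (inj i j (==⇒≡ (f i) (f j) e))) (==-refl j))) (⇒ᵇ-intro (endo i j))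

triangleFree-by-search : (G : Graph n) →
  allᵇ (λ u → allᵇ λ v → adj G u v ⇒ᵇ allᵇ λ w → adj G v w ⇒ᵇ not (adj G u w)) ≡ true → TriangleFree G
triangleFree-by-search G h u v w uv vw uw
  with adj G u w | ⇒ᵇ-elim (allᵇ-elim (⇒ᵇ-elim (allᵇ-elim (allᵇ-elim h u) v) uv) w) vw
triangleFree-by-search G h u v w uv vw () | false | _

-- A vertex with a neighbour has value at most 2 when the values on each edge add up to 2, so
-- `Fin 3` covers all possibilities.
balance : (Fin n → Fin n → Bool) → Fin n → Fin 3 → Fin n → Fin 3 → Bool
balance a i c j e = a i j ⇒ᵇ (toℕ c + toℕ e ≡ᵇ 2)

balance-by-search : (a : Fin n → Fin n → Bool) → forced (balance a) (λ _ → suc zero) ≡ true →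
  (c : Fin n → ℕ) → (∀ v → c v ≤ 2) → (∀ u v → a u v ≡ true → c u + c v ≡ 2) → ∀ v → c v ≡ 1
balance-by-search a h c c≤2 sums v = trans (sym (c≡ v)) (cong toℕ (forced-sound _ _ h c′ compat v))
  where
  c′ : Fin _ → Fin 3
  c′ v = Fin.fromℕ< (s≤s (c≤2 v))
  c≡ : ∀ v → toℕ (c′ v) ≡ c v
  c≡ v = Fin.toℕ-fromℕ< (s≤s (c≤2 v))
  compat : ∀ i j → balance a i (c′ i) j (c′ j) ≡ true
  compat i j = ⇒ᵇ-intro λ ij → T⇒true (≡⇒≡ᵇ _ 2 (trans (cong₂ _+_ (c≡ i) (c≡ j)) (sums i j ij)))
    where
    T⇒true : ∀ {b} → T b → b ≡ true
    T⇒true {true} _ = refl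

unbalanced-by-search : (G : Graph n) → (∀ v → ∃ λ u → adj G v u ≡ true) →
  forced (balance (adj G)) (λ _ → suc zero) ≡ true → Unbalanced G
unbalanced-by-search G nb h c sums = balance-by-search (adj G) h c
  (λ v → subst (c v ≤_) (sums v _ (proj₂ (nb v))) (m≤m+n (c v) _)) sums

regular⇒neighbour : (G : Graph n) → Regular (suc d) G → ∀ v → ∃ λ u → adj G v u ≡ true
regular⇒neighbour G reg v = count-∃ (adj G v) (subst (1 ≤_) (sym (count-degree G reg v)) (s≤s z≤n))

rigid-table : (table : Vec (List ℕ) (suc n)) → isGraph table ≡ true → isRegular table d ≡ true →
  forced (preserves (tableAdj table)) id ≡ true → HasRigidRegular d (suc n)
rigid-table table g r h = s≤s z≤n , tableGraph table g , table-regular table g r , rigid-by-search (tableGraph table g) h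

complement-hasRigidRegular : (H : Graph n) → Regular k H → suc (k + d) ≡ n →
  TriangleFree H → Unbalanced H → Asymmetric H → HasRigidRegular d n
complement-hasRigidRegular H reg refl tf unb asym =
  s≤s z≤n , complement H , complement-regular H reg refl , complement-rigid H reg tf unb asym

-- For larger `d` the rigid graph is dense; here only its sparse complement is searched, and only
-- for injective maps.
rigid-complement-table : (k d : ℕ) (table : Vec (List ℕ) (suc (suc k + d))) → isGraph table ≡ true → isRegular table (suc k) ≡ true →
  allᵇ (λ u → allᵇ λ v → tableAdj table u v ⇒ᵇ allᵇ λ w → tableAdj table v w ⇒ᵇ not (tableAdj table u w)) ≡ true →
  forced (balance (tableAdj table)) (λ _ → suc zero) ≡ true →
  forced (preserves-distinct (tableAdj table)) id ≡ true → HasRigidRegular d (suc (suc k + d))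
rigid-complement-table k d table g r t b a = complement-hasRigidRegular H reg refl (triangleFree-by-search H t)
  (unbalanced-by-search H (regular⇒neighbour H reg) b) (asymmetric-by-search H a)
  where
  H = tableGraph table g
  reg = table-regular table g r

-- Complements of regular graphs of degree at most 2

-- Removing vertex `zero` with its `c` neighbours takes away its row and its column, each of sum
-- `c`.
handshake : (A : Fin n → Fin n → Bool) → (∀ i j → A i j ≡ A j i) → (∀ i → A i i ≡ false) →
  ∃ λ e → sum (λ i → count (A i)) ≡ e + e
handshake {zero}  A A-sym A-irr = 0 , refl
handshake {suc n} A A-sym A-irr with handshake (λ i j → A (suc i) (suc j)) (λ i j → A-sym _ _) (λ i → A-irr _)
... | e , eq = c + e , (begin
  bit (A zero zero) + c + sum (λ i → bit (A (suc i) zero) + count (λ j → A (suc i) (suc j)))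
    ≡⟨ cong₂ _+_ (cong (λ b → bit b + c) (A-irr zero)) (∑-distrib-+ (λ i → bit (A (suc i) zero)) _) ⟩
  c + (sum (λ i → bit (A (suc i) zero)) + sum (λ i → count (λ j → A (suc i) (suc j))))
    ≡⟨ cong (c +_) (cong₂ _+_ (count-cong (λ i → A-sym (suc i) zero)) eq) ⟩
  c + (c + (e + e))
    ≡⟨ sym (+-assoc c c (e + e)) ⟩
  (c + c) + (e + e)
    ≡⟨ +-assoc-comm c c e e ⟩
  (c + e) + (c + e) ∎)
  where
  open ≡-Reasoning
  c = count (A zero ∘ suc)
  +-assoc-comm : ∀ a b x y → (a + b) + (x + y) ≡ (a + x) + (b + y)
  +-assoc-comm a b x y = trans (+-assoc a b (x + y)) (trans (cong (a +_) (trans (sym (+-assoc b x y))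
    (trans (cong (_+ y) (+-comm b x)) (+-assoc x b y)))) (sym (+-assoc a x (b + y))))

odd-regular : (G : Graph n) → Regular d G → parity n ≡ 1ℙ → parity d ≡ 1ℙ → ⊥
odd-regular {n} {d} G reg n-odd d-odd with handshake (adj G) (symmetric G) (irreflex G)
... | e , eq = case trans (sym odd) even of λ ()
  where
  nd≡2e : n * d ≡ e + e
  nd≡2e = trans (sym (trans (sum-cong-≗ (count-degree G reg)) (sum-const n d))) eq
  odd : parity (n * d) ≡ 1ℙ
  odd = trans (parity-* n d) (cong₂ _*ℙ_ n-odd d-odd)
  even : parity (n * d) ≡ 0ℙ
  even = trans (cong parity nd≡2e) (trans (parity-+ e e) (p+p≡0ℙ (parity e)))

count-3≤ : (p : Fin n → Bool) (u v w : Fin n) → u ≢ v → v ≢ w → u ≢ w →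
  p u ≡ true → p v ≡ true → p w ≡ true → 3 ≤ count p
count-3≤ p u v w u≢v v≢w u≢w pu pv pw = begin
  3
    ≡⟨ sym (cong₂ _+_ (count-== u) (cong₂ _+_ (count-== v) (count-== w))) ⟩
  count (_== u) + (count (_== v) + count (_== w))
    ≡⟨ cong (count (_== u) +_) (sym (∑-distrib-+ (bit ∘ (_== v)) (bit ∘ (_== w)))) ⟩
  count (_== u) + sum (λ i → bit (i == v) + bit (i == w))
    ≡⟨ sym (∑-distrib-+ (bit ∘ (_== u)) (λ i → bit (i == v) + bit (i == w))) ⟩
  sum (λ i → bit (i == u) + (bit (i == v) + bit (i == w)))
    ≤⟨ sum-mono-≤ le ⟩
  count p ∎
  where
  open ≤-Reasoning
  le : ∀ i → bit (i == u) + (bit (i == v) + bit (i == w)) ≤ bit (p i)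
  le i with i Fin.≟ u
  ... | yes refl rewrite ==-≢ u≢v | ==-≢ u≢w | pu = ≤-refl
  ... | no _ with i Fin.≟ v
  ...   | yes refl rewrite ==-≢ v≢w | pv = ≤-refl
  ...   | no _ with i Fin.≟ w
  ...     | yes refl rewrite pw = ≤-refl
  ...     | no _ = z≤n

module Matching (H : Graph n) (reg : Regular 1 H) where

  mate : ∀ v → ∃ λ u → adj H v u ≡ true
  mate v = count-∃ (adj H v) (≤-reflexive (sym (count-degree H reg v)))

  swap : Fin n → Fin n
  swap = proj₁ ∘ mate

  neighbours-equal : ∀ {v u w} → adj H v u ≡ true → adj H v w ≡ true → u ≡ w
  neighbours-equal {v} {u} {w} vu vw with u Fin.≟ w
  ... | yes e = e
  ... | no ¬e = contradiction (≤-trans (count-2≤ (adj H v) u w ¬e vu vw) (≤-reflexive (count-degree H reg v))) 1+n≰n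

  swap-inj : Inj swap
  swap-inj u v e = neighbours-equal (trans (symmetric H _ _) (proj₂ (mate u)))
    (trans (symmetric H _ _) (subst (λ w → adj H v w ≡ true) (sym e) (proj₂ (mate v))))

  swap-endo : IsEndomorphism H swap
  swap-endo u v uv = subst₂ (λ a b → adj H a b ≡ true) (neighbours-equal uv (proj₂ (mate u)))
    (neighbours-equal (trans (symmetric H v u) uv) (proj₂ (mate v))) (trans (symmetric H v u) uv)

  swap-moves : ∀ v → swap v ≢ v
  swap-moves v e = adj⇒≢ H (proj₂ (mate v)) (sym e)

-- A walk without backtracking: each vertex is left by the neighbour other than the one it was
-- entered from. Indexing by ℕ avoids choosing the length of the cycle in advance.
cyclicWalk : (H : Graph n) → Regular 2 H → Fin n →
  ∃ λ (x : ℕ → Fin n) → (∀ i → adj H (x i) (x (suc i)) ≡ true) × (∀ i → x (2 + i) ≢ x i)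
cyclicWalk {n} H reg v₀ = proj₁ ∘ walk , (λ i → proj₂ (proj₂ (walk i))) , (λ i → proj₁ (proj₂ (onward (walk i))))
  where
  Dart : Set
  Dart = ∃₂ λ u v → adj H u v ≡ true
  onward : ((u , v , _) : Dart) → ∃ λ w → w ≢ u × adj H v w ≡ true
  onward (u , v , uv) with count-∃₂ (adj H v) (≤-reflexive (sym (count-degree H reg v)))
  ... | a , b , a≢b , va , vb with a Fin.≟ u
  ...   | yes refl = b , a≢b ∘ sym , vb
  ...   | no a≢u   = a , a≢u , va
  walk : ℕ → Dart
  walk zero    = v₀ , count-∃ (adj H v₀) (≤-trans (s≤s z≤n) (≤-reflexive (sym (count-degree H reg v₀))))
  walk (suc i) = let (u , v , _) = walk i ; (w , _ , vw) = onward (walk i) in v , w , vw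

-- The automorphism moves the component of the walk one step along and fixes the rest. It is well
-- defined and injective only if two visits to a vertex continue alike in both directions, which is
-- what `forward` and `backward` provide.
module Cycle (H : Graph n) (reg : Regular 2 H) (x : ℕ → Fin n)
  (x-adj : ∀ i → adj H (x i) (x (suc i)) ≡ true) (x-≢ : ∀ i → x (2 + i) ≢ x i) where

  x-neighbours : ∀ i y → adj H (x (suc i)) y ≡ true → y ≡ x i ⊎ y ≡ x (2 + i)
  x-neighbours i y xy with y Fin.≟ x i | y Fin.≟ x (2 + i)
  ... | yes e | _     = inj₁ e
  ... | _     | yes e = inj₂ e
  ... | no ¬e | no ¬e′ = contradiction
    (≤-trans (count-3≤ (adj H (x (suc i))) y (x i) (x (2 + i)) ¬e (x-≢ i ∘ sym) ¬e′ xy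
               (trans (symmetric H _ _) (x-adj i)) (x-adj (suc i)))
             (≤-reflexive (count-degree H reg (x (suc i))))) 1+n≰n

  -- A walk that traverses an edge in both directions would have to turn round somewhere in between.
  no-reversal-≤ : ∀ l i → x i ≡ x (suc (l + i)) → x (suc i) ≡ x (l + i) → ⊥
  no-reversal-≤ zero          i e e′ = adj⇒≢ H (x-adj i) e
  no-reversal-≤ (suc zero)    i e e′ = x-≢ i (sym e)
  no-reversal-≤ (suc (suc l)) i e e′
    with x-neighbours (suc (l + i)) (x (2 + i)) (subst (λ v → adj H v (x (2 + i)) ≡ true) e′ (x-adj (suc i)))
  ... | inj₂ e″ = x-≢ i (trans e″ (sym e))
  ... | inj₁ e″ = no-reversal-≤ l (suc i) (trans e′ (cong (x ∘ suc) (sym (+-suc l i)))) (trans e″ (cong x (sym (+-suc l i))))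

  no-reversal : ∀ i j → x i ≡ x (suc j) → x (suc i) ≡ x j → ⊥
  no-reversal i j e e′ with ≤-total i j
  ... | inj₁ i≤j = no-reversal-≤ (j ∸ i) i (trans e (cong (x ∘ suc) (sym (m∸n+n≡m i≤j)))) (trans e′ (cong x (sym (m∸n+n≡m i≤j))))
  ... | inj₂ j≤i = no-reversal-≤ (i ∸ j) j (trans (sym e′) (cong (x ∘ suc) (sym (m∸n+n≡m j≤i)))) (trans (sym e) (cong x (sym (m∸n+n≡m j≤i))))

  -- The only other way to continue is back to `x i`, and then the walk would traverse an edge in
  -- both directions.
  forward : ∀ i j → x (suc i) ≡ x (suc j) → x (2 + i) ≡ x (2 + j)
  forward i j e with x-neighbours i (x (2 + j)) (subst (λ v → adj H v (x (2 + j)) ≡ true) (sym e) (x-adj (suc j)))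
  ... | inj₂ e′ = sym e′
  ... | inj₁ e′ = ⊥-elim (no-reversal i (suc j) (sym e′) e)

  backward : ∀ i j → x (suc i) ≡ x (suc j) → x i ≡ x j
  backward i j e with x-neighbours j (x i) (subst (λ v → adj H v (x i) ≡ true) e (trans (symmetric H _ _) (x-adj i)))
  ... | inj₁ e′ = e′
  ... | inj₂ e′ = ⊥-elim (no-reversal i (suc j) e′ e)

  -- By pigeonhole some vertex is visited twice, and `backward` shifts the coincidence down to index
  -- 1. Indices start at 1 because a visit needs a predecessor for its neighbours to be known.
  period : ∃ λ p → x 1 ≡ x (2 + p)
  period with Fin.pigeonhole (n<1+n n) (x ∘ suc ∘ toℕ)
  ... | i , j , i<j , e with m≤n⇒∃[o]m+o≡n i<j
  ...   | p , i+p≡j = p , back (toℕ i) (suc p) (trans e (cong (x ∘ suc) (trans (sym i+p≡j) (sym (+-suc (toℕ i) p)))))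
    where
    back : ∀ i p → x (suc i) ≡ x (suc (i + p)) → x 1 ≡ x (suc p)
    back zero    p e = e
    back (suc i) p e = back i p (backward (suc i) (suc (i + p)) e)

  p : ℕ
  p = proj₁ period

  -- All vertices of the walk occur within one period, which makes `OnCycle` decidable by a finite
  -- search.
  cover : ∀ l → ∃ λ (i : Fin (suc p)) → x (suc (toℕ i)) ≡ x (suc l)
  cover zero    = zero , refl
  cover (suc l) with cover l
  ... | i , e with suc (toℕ i) <? suc p
  ...   | yes i<p = fromℕ< i<p , trans (cong (x ∘ suc) (Fin.toℕ-fromℕ< i<p)) (forward (toℕ i) l e)
  ...   | no  i≮p = zero , trans (proj₂ period) (trans (cong (x ∘ suc) (≤-antisym (≮⇒≥ i≮p) (Fin.toℕ<n i))) (forward (toℕ i) l e))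

  OnCycle : Fin n → Set
  OnCycle v = ∃ λ i → x (suc i) ≡ v

  onCycle? : ∀ v → Dec (OnCycle v)
  onCycle? v with Fin.any? (λ (i : Fin (suc p)) → x (suc (toℕ i)) Fin.≟ v)
  ... | yes (i , e) = yes (toℕ i , e)
  ... | no none     = no λ (l , e) → none (proj₁ (cover l) , trans (proj₂ (cover l)) e)

  rotate : Fin n → Fin n
  rotate v with onCycle? v
  ... | yes (i , _) = x (2 + i)
  ... | no _        = v

  rotate-x : ∀ i → rotate (x (suc i)) ≡ x (2 + i)
  rotate-x i with onCycle? (x (suc i))
  ... | yes (j , e) = forward j i e
  ... | no none     = contradiction (i , refl) none

  rotate-off : ∀ {v} → ¬ OnCycle v → rotate v ≡ v
  rotate-off {v} off with onCycle? v
  ... | yes on = contradiction on off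
  ... | no _   = refl

  -- Going once round the cycle raises the index, so that the predecessor of `v` also has the form
  -- `x (suc _)` required by `rotate-x`.
  onCycle-≥2 : ∀ {v} → OnCycle v → ∃ λ i → x (2 + i) ≡ v
  onCycle-≥2 (zero  , e) = p , trans (sym (proj₂ period)) e
  onCycle-≥2 (suc i , e) = i , e

  rotate-edge : ∀ i v → adj H (x (2 + i)) v ≡ true → OnCycle v × adj H (x (3 + i)) (rotate v) ≡ true
  rotate-edge i v iv with x-neighbours (suc i) v iv
  ... | inj₁ refl = (i , refl) , trans (cong (adj H (x (3 + i))) (rotate-x i)) (trans (symmetric H _ _) (x-adj (2 + i)))
  ... | inj₂ refl = (2 + i , refl) , trans (cong (adj H (x (3 + i))) (rotate-x (2 + i))) (x-adj (3 + i))

  rotate-on : ∀ {u v} → adj H u v ≡ true → (∃ λ i → x (2 + i) ≡ u) → OnCycle v × adj H (rotate u) (rotate v) ≡ true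
  rotate-on {u} {v} uv (i , e) with rotate-edge i v (subst (λ w → adj H w v ≡ true) (sym e) uv)
  ... | on , h = on , subst (λ w → adj H w (rotate v) ≡ true) (trans (sym (rotate-x (suc i))) (cong rotate e)) h

  rotate-endo : IsEndomorphism H rotate
  rotate-endo u v uv = cases (onCycle? u) (onCycle? v)
    where
    cases : Dec (OnCycle u) → Dec (OnCycle v) → adj H (rotate u) (rotate v) ≡ true
    cases (yes on) _        = proj₂ (rotate-on uv (onCycle-≥2 on))
    cases (no off) (yes on) = contradiction (proj₁ (rotate-on (trans (symmetric H v u) uv) (onCycle-≥2 on))) off
    cases (no off) (no off′) = subst₂ (λ a b → adj H a b ≡ true) (sym (rotate-off off)) (sym (rotate-off off′)) uv

  rotate-inj : Inj rotate
  rotate-inj u v e with onCycle? u | onCycle? v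
  ... | no _         | no _         = e
  ... | yes (i , eᵢ) | yes (j , eⱼ) = trans (sym eᵢ) (trans (backward (suc i) (suc j) e) eⱼ)
  ... | yes (i , _)  | no off       = contradiction (suc i , e) off
  ... | no off       | yes (j , _)  = contradiction (suc j , sym e) off

  rotate-moves : rotate (x 1) ≢ x 1
  rotate-moves e = adj⇒≢ H (x-adj 1) (sym (trans (sym (rotate-x 0)) e))

rigid-regular-order : 3 ≤ d → n < d + 4 → ¬ HasRigidRegular d n
rigid-regular-order {d} {n} 3≤d n<d+4 (1≤n , G , reg , rigid) = go (n ∸ suc d) refl
  where
  d<n : d < n
  d<n = degree<n G reg 1≤n
  H : Graph n
  H = complement G
  v₀ : Fin n
  v₀ = fromℕ< 1≤n
  v₁ : Fin n
  v₁ = fromℕ< (≤-trans (s≤s (≤-trans (s≤s z≤n) 3≤d)) d<n)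
  v₀≢v₁ : v₀ ≢ v₁
  v₀≢v₁ e = case trans (sym (Fin.toℕ-fromℕ< 1≤n)) (trans (cong toℕ e) (Fin.toℕ-fromℕ< _)) of λ ()
  H-regular : ∀ {r} → n ∸ suc d ≡ r → Regular r H
  H-regular e = complement-regular G reg (trans (cong (suc d +_) (sym e)) (m+[n∸m]≡n d<n))
  -- The complement has degree `r`. It is edgeless, a perfect matching or a union of cycles, with a
  -- transposition, the exchange of all matched pairs or the rotation of one cycle as its symmetry.
  go : ∀ r → n ∸ suc d ≡ r → ⊥
  go 0 e = automorphism⇒¬Rigid G reg (transpose v₀ v₁) (transpose-inj v₀ v₁)
    (λ u v uv → case subst (1 ≤_) (count-degree H (H-regular e) u) (count-1≤ (adj H u) v uv) of λ ())
    (v₀ , λ e′ → v₀≢v₁ (sym (trans (sym (transpose-left v₀ v₁)) e′))) rigid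
    where
    transpose-left : ∀ (i j : Fin n) → transpose i j i ≡ j
    transpose-left i j rewrite ==-refl i = refl
  go 1 e = automorphism⇒¬Rigid G reg swap swap-inj swap-endo (v₀ , swap-moves v₀) rigid
    where open Matching H (H-regular e)
  go 2 e = automorphism⇒¬Rigid G reg rotate rotate-inj rotate-endo (_ , rotate-moves) rigid
    where
    w = cyclicWalk H (H-regular e) v₀
    open Cycle H (H-regular e) (proj₁ w) (proj₁ (proj₂ w)) (proj₂ (proj₂ w))
  go (suc (suc (suc r))) e = <⇒≱ n<d+4 (begin
    d + 4           ≡⟨ trans (+-comm d 4) (cong suc (+-comm 3 d)) ⟩
    suc d + 3       ≤⟨ +-monoʳ-≤ (suc d) (≤-trans (s≤s (s≤s (s≤s z≤n))) (≤-reflexive (sym e))) ⟩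
    suc d + (n ∸ suc d) ≡⟨ m+[n∸m]≡n d<n ⟩
    n ∎)
    where open ≤-Reasoning

-- Enumeration of regular graphs

infixr 5 _∷_
-- The upper triangle of an adjacency matrix: each row concerns later vertices only, so symmetry and
-- irreflexivity hold by construction.
data Tri : ℕ → Set where
  []  : Tri 0
  _∷_ : Vec Bool n → Tri n → Tri (suc n)

triAdj : Tri n → Fin n → Fin n → Bool
triAdj (r ∷ T) zero    zero    = false
triAdj (r ∷ T) zero    (suc j) = lookup r j
triAdj (r ∷ T) (suc i) zero    = lookup r i
triAdj (r ∷ T) (suc i) (suc j) = triAdj T i j

triAdj-sym : (T : Tri n) → ∀ i j → triAdj T i j ≡ triAdj T j i
triAdj-sym (r ∷ T) zero    zero    = refl
triAdj-sym (r ∷ T) zero    (suc j) = refl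
triAdj-sym (r ∷ T) (suc i) zero    = refl
triAdj-sym (r ∷ T) (suc i) (suc j) = triAdj-sym T i j

-- Every row with `need` neighbours among vertices of the given remaining degrees is passed on, except
-- that the vertices from position t on, which are interchangeable, are chosen in order.
-- The continuation also receives the new remaining degrees and the new value of t.
rows : (t need : ℕ) (ds : Vec ℕ m) → (Vec Bool m → Vec ℕ m → ℕ → Bool) → Bool
rows t       zero       ds             k = k (replicate _ false) ds t
rows t       (suc need) []             k = true
-- At `t = 0` all positions are interchangeable, so a row in order must take the first one. If that
-- one is saturated there is no such row, and the claim holds vacuously.
rows zero    (suc need) (zero ∷ ds)    k = true
rows zero    (suc need) (suc x ∷ ds)   k = rows zero need ds λ r ds′ t′ → k (true ∷ r) (x ∷ ds′) (suc t′)
rows (suc t) (suc need) (zero ∷ ds)    k = rows t (suc need) ds λ r ds′ t′ → k (false ∷ r) (zero ∷ ds′) (suc t′)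
rows (suc t) (suc need) (suc x ∷ ds)   k =
  rows t need ds (λ r ds′ t′ → k (true ∷ r) (x ∷ ds′) (suc t′)) ∧
  rows t (suc need) ds (λ r ds′ t′ → k (false ∷ r) (suc x ∷ ds′) (suc t′))

-- The predecessor accounts for the removal of the head vertex from the positions. The result is the
-- conjunction of `k` over all graphs generated.
enumerate : (t : ℕ) (ds : Vec ℕ m) → (Tri m → Bool) → Bool
enumerate t []       k = k []
enumerate t (d ∷ ds) k = rows (pred t) d ds λ r ds′ t′ → enumerate t′ ds′ λ T → k (r ∷ T)

-- The normal form under permutations of the positions from `t` on: the chosen ones among them come
-- first.
SortedFrom : ℕ → (Fin m → Bool) → Set
SortedFrom t r = ∀ i j → t ≤ toℕ i → i Fin.< j → r j ≡ true → r i ≡ true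

Fixes : ℕ → (Fin m → Fin m) → Set
Fixes t π = ∀ i → toℕ i < t → π i ≡ i

fixes-≥ : {π : Fin m → Fin m} → Inj π → Fixes t π → ∀ i → t ≤ toℕ i → t ≤ toℕ (π i)
fixes-≥ {π = π} inj fix i t≤i = ≮⇒≥ λ πi<t → <⇒≱ πi<t (subst (λ j → _ ≤ toℕ j) (sym (inj _ _ (fix (π i) πi<t))) t≤i)

lift₁ : (Fin m → Fin m) → Fin (suc m) → Fin (suc m)
lift₁ π zero    = zero
lift₁ π (suc i) = suc (π i)

lift₁-inj : {π : Fin m → Fin m} → Inj π → Inj (lift₁ π)
lift₁-inj inj zero    zero    e = refl
lift₁-inj inj (suc u) (suc v) e = cong suc (inj u v (Fin.suc-injective e))

-- Selection sort: a transposition brings some chosen position to the front, and the tail is sorted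
-- recursively.
sortFrom : ∀ t (r : Fin m → Bool) → ∃ λ π → Inj π × Fixes t π × SortedFrom t (r ∘ π)
sortFrom {zero} t r = id , (λ _ _ e → e) , (λ ()) , λ ()
sortFrom {suc m} (suc t) r with sortFrom t (r ∘ suc)
... | π , inj , fix , sorted = lift₁ π , lift₁-inj inj ,
  (λ { zero _ → refl ; (suc i) i<t → cong suc (fix i (s<s⁻¹ i<t)) }) ,
  λ { (suc i) (suc j) t≤i i<j → sorted i j (s≤s⁻¹ t≤i) (s<s⁻¹ i<j) }
sortFrom {suc m} zero r with Fin.any? (λ j → r j Bool.≟ true)
... | no none = id , (λ _ _ e → e) , (λ i ()) , λ i j _ _ rj → contradiction (j , rj) none
... | yes (j , rj) with sortFrom zero (r ∘ transpose zero j ∘ suc)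
...   | π , inj , _ , sorted = transpose zero j ∘ lift₁ π ,
  (λ u v e → lift₁-inj inj u v (transpose-inj zero j _ _ e)) , (λ i ()) ,
  λ { zero    _       _ _   _ → rj
    ; (suc i) (suc j) _ i<j   → sorted i j z≤n (s<s⁻¹ i<j) }

-- The row of an actual graph, once sorted, is among those passed on. Here `e` holds the degrees
-- left after its edges are removed. From `t′` on the row is `false`, so those vertices are
-- untouched and remain interchangeable.
rows-sound : ∀ t need (ds : Vec ℕ m) {k} (r : Fin m → Bool) (e : Fin m → ℕ) →
  (∀ i → lookup ds i ≡ bit (r i) + e i) → count r ≡ need → SortedFrom t r → rows t need ds k ≡ true →
  ∃ λ t′ → t ≤ t′ × (∀ i → t′ ≤ toℕ i → r i ≡ false) × k (tabulate r) (tabulate e) t′ ≡ true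
rows-sound {m} t zero ds {k} r e split cnt sorted h = t , ≤-refl , (λ i _ → none i) ,
  subst₂ (λ x y → k x y t ≡ true) (sym row≡) degrees≡ h
  where
  none : ∀ i → r i ≡ false
  none i = ¬true λ ri → case subst (1 ≤_) cnt (count-1≤ r i ri) of λ ()
  row≡ : tabulate r ≡ replicate _ false
  row≡ = trans (tabulate-cong (λ i → trans (none i) (sym (lookup-replicate i false)))) (tabulate∘lookup _)
  degrees≡ : ds ≡ tabulate e
  degrees≡ = trans (sym (tabulate∘lookup ds)) (tabulate-cong λ i → trans (split i) (cong (λ b → bit b + e i) (none i)))
rows-sound zero (suc need) (zero ∷ ds) r e split cnt sorted h
  with r zero in r₀ | count-∃ r (subst (1 ≤_) (sym cnt) (s≤s z≤n))
... | true  | _            = contradiction (trans (split zero) (cong (λ b → bit b + e zero) r₀)) λ ()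
... | false | zero  , rj   = contradiction (trans (sym rj) r₀) true≢false
... | false | suc j , rj   = contradiction (trans (sym (sorted zero (suc j) z≤n z<s rj)) r₀) true≢false
rows-sound zero (suc need) (suc x ∷ ds) {k} r e split cnt sorted h
  with r zero in r₀ | count-∃ r (subst (1 ≤_) (sym cnt) (s≤s z≤n))
... | false | zero  , rj   = contradiction (trans (sym rj) r₀) true≢false
... | false | suc j , rj   = contradiction (trans (sym (sorted zero (suc j) z≤n z<s rj)) r₀) true≢false
... | true  | _ with rows-sound zero need ds (r ∘ suc) (e ∘ suc) (split ∘ suc)
                     (suc-injective (trans (cong (λ b → bit b + count (r ∘ suc)) (sym r₀)) cnt))
                     (λ i j _ i<j → sorted (suc i) (suc j) z≤n (s<s i<j)) h
...   | t′ , _ , fresh , kh = suc t′ , z≤n , (λ { (suc i) t≤i → fresh i (s≤s⁻¹ t≤i) }) ,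
  subst (λ y → k (true ∷ tabulate (r ∘ suc)) (y ∷ tabulate (e ∘ suc)) (suc t′) ≡ true)
    (suc-injective (trans (split zero) (cong (λ b → bit b + e zero) r₀))) kh
rows-sound (suc t) (suc need) (zero ∷ ds) {k} r e split cnt sorted h with r zero in r₀
... | true  = contradiction (trans (split zero) (cong (λ b → bit b + e zero) r₀)) λ ()
... | false with rows-sound t (suc need) ds (r ∘ suc) (e ∘ suc) (split ∘ suc)
                     cnt
                     (λ i j t≤i i<j → sorted (suc i) (suc j) (s≤s t≤i) (s<s i<j)) h
...   | t′ , t≤t′ , fresh , kh = suc t′ , s≤s t≤t′ , (λ { (suc i) t≤i → fresh i (s≤s⁻¹ t≤i) }) ,
  subst (λ y → k (false ∷ tabulate (r ∘ suc)) (y ∷ tabulate (e ∘ suc)) (suc t′) ≡ true)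
    (trans (split zero) (cong (λ b → bit b + e zero) r₀)) kh
rows-sound (suc t) (suc need) (suc x ∷ ds) {k} r e split cnt sorted h with r zero in r₀
... | true  with rows-sound t need ds (r ∘ suc) (e ∘ suc) (split ∘ suc)
                     (suc-injective cnt)
                     (λ i j t≤i i<j → sorted (suc i) (suc j) (s≤s t≤i) (s<s i<j)) (proj₁ (∧-elim h))
...   | t′ , t≤t′ , fresh , kh = suc t′ , s≤s t≤t′ , (λ { (suc i) t≤i → fresh i (s≤s⁻¹ t≤i) }) ,
  subst (λ y → k (true ∷ tabulate (r ∘ suc)) (y ∷ tabulate (e ∘ suc)) (suc t′) ≡ true)
    (suc-injective (trans (split zero) (cong (λ b → bit b + e zero) r₀))) kh
rows-sound (suc t) (suc need) (suc x ∷ ds) {k} r e split cnt sorted h | false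
            with rows-sound t (suc need) ds (r ∘ suc) (e ∘ suc) (split ∘ suc)
                     cnt
                     (λ i j t≤i i<j → sorted (suc i) (suc j) (s≤s t≤i) (s<s i<j))
                     (proj₂ (∧-elim {rows t need ds (λ r ds′ t′ → k (true ∷ r) (x ∷ ds′) (suc t′))} h))
...   | t′ , t≤t′ , fresh , kh = suc t′ , s≤s t≤t′ , (λ { (suc i) t≤i → fresh i (s≤s⁻¹ t≤i) }) ,
  subst (λ y → k (false ∷ tabulate (r ∘ suc)) (y ∷ tabulate (e ∘ suc)) (suc t′) ≡ true)
    (trans (split zero) (cong (λ b → bit b + e zero) r₀)) kh

n≤1+pred[n] : ∀ n → n ≤ suc (pred n)
n≤1+pred[n] zero    = z≤n
n≤1+pred[n] (suc n) = ≤-refl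

-- First `π₁` sorts the row of the head, then `π₂` relabels the tail recursively. As `π₂` moves only
-- positions from `t′` on, where that row is constantly `false`, it does not disturb the row already
-- chosen.
enumerate-sound : ∀ t (ds : Vec ℕ m) {k} → enumerate t ds k ≡ true →
  (A : Fin m → Fin m → Bool) → (∀ i j → A i j ≡ A j i) → (∀ i → A i i ≡ false) →
  (∀ i → count (A i) ≡ lookup ds i) → (∀ i j → t ≤ toℕ i → t ≤ toℕ j → lookup ds i ≡ lookup ds j) →
  ∃₂ λ π T → Inj π × Fixes t π × (∀ i j → triAdj T i j ≡ A (π i) (π j)) × k T ≡ true
enumerate-sound t [] h A A-sym A-irr deg fresh = id , [] , (λ _ _ e → e) , (λ ()) , (λ ()) , h
enumerate-sound {suc m} t (d ∷ ds) h A A-sym A-irr deg fresh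
  with sortFrom (pred t) (A zero ∘ suc)
... | π₁ , π₁-inj , fix₁ , sorted
  with rows-sound (pred t) d ds (A zero ∘ suc ∘ π₁) (λ i → count (λ j → A (suc (π₁ i)) (suc (π₁ j))))
         split (trans (count-reindex π₁ π₁-inj (A zero ∘ suc)) (trans (cong (λ b → bit b + count (A zero ∘ suc)) (sym (A-irr zero))) (deg zero))) sorted h
  where
  same : ∀ i → lookup ds (π₁ i) ≡ lookup ds i
  same i with toℕ i <? pred t
  ... | yes i<t = cong (lookup ds) (fix₁ i i<t)
  ... | no  i≮t = fresh (suc (π₁ i)) (suc i) (≤-trans (n≤1+pred[n] t) (s≤s (fixes-≥ π₁-inj fix₁ i (≮⇒≥ i≮t)))) (≤-trans (n≤1+pred[n] t) (s≤s (≮⇒≥ i≮t)))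
  split : ∀ i → lookup ds i ≡ bit (A zero (suc (π₁ i))) + count (λ j → A (suc (π₁ i)) (suc (π₁ j)))
  split i = trans (sym (trans (deg (suc (π₁ i))) (same i)))
    (cong₂ _+_ (cong bit (A-sym _ _)) (sym (count-reindex π₁ π₁-inj (A (suc (π₁ i)) ∘ suc))))
... | t′ , t≤t′ , noFresh , kh
  with enumerate-sound t′ (tabulate λ i → count (λ j → A (suc (π₁ i)) (suc (π₁ j)))) kh (λ i j → A (suc (π₁ i)) (suc (π₁ j))) (λ i j → A-sym _ _) (λ i → A-irr _)
         (λ i → sym (lookup∘tabulate (λ i → count (λ j → A (suc (π₁ i)) (suc (π₁ j)))) i)) fresh′
  where
  -- Vertices from `t′` on are not adjacent to the removed head, so they keep their full degree and
  -- these degrees stay equal.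
  count-tail : ∀ i → t′ ≤ toℕ i → count (λ j → A (suc (π₁ i)) (suc (π₁ j))) ≡ count (A (suc (π₁ i)))
  count-tail i t′≤i = trans (count-reindex π₁ π₁-inj (A (suc (π₁ i)) ∘ suc))
    (cong (λ b → bit b + count (A (suc (π₁ i)) ∘ suc)) (sym (trans (A-sym _ _) (noFresh i t′≤i))))
  far : ∀ i → t′ ≤ toℕ i → t ≤ toℕ (suc (π₁ i))
  far i t′≤i = ≤-trans (n≤1+pred[n] t) (s≤s (fixes-≥ π₁-inj fix₁ i (≤-trans t≤t′ t′≤i)))
  fresh′ : ∀ i j → t′ ≤ toℕ i → t′ ≤ toℕ j →
    lookup (tabulate λ i → count (λ j → A (suc (π₁ i)) (suc (π₁ j)))) i ≡ lookup (tabulate λ i → count (λ j → A (suc (π₁ i)) (suc (π₁ j)))) j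
  fresh′ i j t′≤i t′≤j = trans (trans (lookup∘tabulate _ i) (trans (count-tail i t′≤i) (deg (suc (π₁ i)))))
    (trans (fresh _ _ (far i t′≤i) (far j t′≤j)) (sym (trans (lookup∘tabulate _ j) (trans (count-tail j t′≤j) (deg (suc (π₁ j)))))))
... | π₂ , T , π₂-inj , fix₂ , T≡A , kT =
  lift₁ (π₁ ∘ π₂) , tabulate (A zero ∘ suc ∘ π₁) ∷ T , lift₁-inj (λ u v e → π₂-inj u v (π₁-inj _ _ e)) , fix , T′≡A , kT
  where
  fix : Fixes t (lift₁ (π₁ ∘ π₂))
  fix zero    _   = refl
  fix (suc i) i<t = cong suc (trans (cong π₁ (fix₂ i (≤-trans (≤-pred′ i<t) t≤t′))) (fix₁ i (≤-pred′ i<t)))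
    where
    ≤-pred′ : ∀ {a t} → suc a < t → a < pred t
    ≤-pred′ {t = suc t} p = s<s⁻¹ p
  row : ∀ j → lookup (tabulate (A zero ∘ suc ∘ π₁)) j ≡ A zero (suc (π₁ (π₂ j)))
  row j with toℕ j <? t′
  ... | yes j<t′ = trans (lookup∘tabulate _ j) (cong (λ j → A zero (suc (π₁ j))) (sym (fix₂ j j<t′)))
  ... | no  j≮t′ = trans (lookup∘tabulate _ j) (trans (noFresh j (≮⇒≥ j≮t′)) (sym (noFresh (π₂ j) (fixes-≥ π₂-inj fix₂ j (≮⇒≥ j≮t′)))))
  T′≡A : ∀ i j → triAdj (tabulate (A zero ∘ suc ∘ π₁) ∷ T) i j ≡ A (lift₁ (π₁ ∘ π₂) i) (lift₁ (π₁ ∘ π₂) j)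
  T′≡A zero    zero    = sym (A-irr zero)
  T′≡A zero    (suc j) = row j
  T′≡A (suc i) zero    = trans (row i) (A-sym _ _)
  T′≡A (suc i) (suc j) = T≡A i j

-- Search for non-trivial endomorphisms

NontrivialEndomorphism : (Fin n → Fin n → Bool) → (Fin n → Fin n) → Set
NontrivialEndomorphism a f = (∀ u v → a u v ≡ true → a (f u) (f v) ≡ true) × ∃ λ v → f v ≢ v

-- A possible image with its number and neighbour list stored as naturals for fast comparison. The
-- stored data only prune the search; the map found is checked afresh, so nothing has to be proved
-- about them.
record Candidate (n : ℕ) : Set where
  constructor candidate
  field
    vertex     : Fin n
    label      : ℕ
    neighbours : List ℕ
open Candidate

trues : ℕ → Vec Bool m → List ℕ
trues o []          = []
trues o (true  ∷ r) = o ∷ trues (suc o) r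
trues o (false ∷ r) = trues (suc o) r

neighbourLists : ℕ → Tri m → Vec (List ℕ) m
neighbourLists o []      = []
neighbourLists o (r ∷ T) = trues (suc o) r ∷
  zipWith (λ b ns → if b then o ∷ ns else ns) r (neighbourLists (suc o) T)

candidates : Tri n → List (Candidate n)
candidates T = toList (zipWith (λ v ns → candidate v (toℕ v) ns) (tabulate id) (neighbourLists 0 T))

anyᴸ : {A : Set} → (A → Bool) → List A → Bool
anyᴸ p []       = false
anyᴸ p (x ∷ xs) = p x ∨ anyᴸ p xs

∨-elim : ∀ {a b} → a ≢ true → (a ∨ b) ≡ true → b ≡ true
∨-elim {true}  h _ = contradiction refl h
∨-elim {false} _ h = h

anyᴸ-elim : {A : Set} {p : A → Bool} (xs : List A) → anyᴸ p xs ≡ true → ∃ λ x → p x ≡ true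
anyᴸ-elim {p = p} (x ∷ xs) h with p x in eq
... | true  = x , eq
... | false = anyᴸ-elim xs h

-- Forward checking: once a vertex is sent to `c`, the domains of its later neighbours shrink to
-- neighbours of `c`. The continuation is the final test, at which the identity is rejected and the
-- search goes on.
search : Bool → Tri m → Vec (List (Candidate n)) m → List ℕ → (Vec (Candidate n) m → Bool) → Bool
search inj []      []       used k = k []
search inj (r ∷ T) (D ∷ Ds) used k = anyᴸ
  (λ c → not (inj ∧ (label c ∈ᵇ used)) ∧
         search inj T (zipWith (λ b D → if b then filterᵇ (λ c′ → label c′ ∈ᵇ neighbours c) D else D) r Ds)
                (label c ∷ used) (λ cs → k (c ∷ cs)))
  D

search-elim : ∀ inj (T : Tri m) (Ds : Vec (List (Candidate n)) m) used {k} → search inj T Ds used k ≡ true →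
  ∃ λ cs → k cs ≡ true
search-elim inj []      []       used h = [] , h
search-elim inj (r ∷ T) (D ∷ Ds) used h with anyᴸ-elim D h
... | c , hc with search-elim inj T _ (label c ∷ used) (proj₂ (∧-elim {not (inj ∧ (label c ∈ᵇ used))} hc))
...   | cs , kcs = c ∷ cs , kcs

rowPreserved : (Fin n → Fin n → Bool) → Fin n → Vec Bool m → Vec (Fin n) m → Bool
rowPreserved a x []          []       = true
rowPreserved a x (true  ∷ r) (y ∷ ys) = a x y ∧ rowPreserved a x r ys
rowPreserved a x (false ∷ r) (y ∷ ys) = rowPreserved a x r ys

triPreserved : (Fin n → Fin n → Bool) → Tri m → Vec (Fin n) m → Bool
triPreserved a []      []       = true
triPreserved a (r ∷ T) (x ∷ xs) = rowPreserved a x r xs ∧ triPreserved a T xs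

rowPreserved-elim : ∀ {a : Fin n → Fin n → Bool} {x} (r : Vec Bool m) ys → rowPreserved a x r ys ≡ true →
  ∀ j → lookup r j ≡ true → a x (lookup ys j) ≡ true
rowPreserved-elim (true  ∷ r) (y ∷ ys) h zero    e = proj₁ (∧-elim h)
rowPreserved-elim {a = a} {x} (true  ∷ r) (y ∷ ys) h (suc j) e = rowPreserved-elim r ys (proj₂ (∧-elim {a x y} h)) j e
rowPreserved-elim (false ∷ r) (y ∷ ys) h (suc j) e = rowPreserved-elim r ys h j e

triPreserved-elim : ∀ {a : Fin n → Fin n → Bool} → (∀ u v → a u v ≡ a v u) → (T : Tri m) (xs : Vec (Fin n) m) →
  triPreserved a T xs ≡ true → ∀ i j → triAdj T i j ≡ true → a (lookup xs i) (lookup xs j) ≡ true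
triPreserved-elim a-sym (r ∷ T) (x ∷ xs) h zero    (suc j) e = rowPreserved-elim r xs (proj₁ (∧-elim h)) j e
triPreserved-elim a-sym (r ∷ T) (x ∷ xs) h (suc i) zero    e = trans (a-sym _ _) (rowPreserved-elim r xs (proj₁ (∧-elim h)) i e)
triPreserved-elim {a = a} a-sym (r ∷ T) (x ∷ xs) h (suc i) (suc j) e =
  triPreserved-elim a-sym T xs (proj₂ (∧-elim {rowPreserved a x r xs} h)) i j e

distinct : Vec ℕ m → Bool
distinct []       = true
distinct (x ∷ xs) = not (x ∈ᵇ toList xs) ∧ distinct xs

≡⇒≡ᵇ-true : ∀ {x y} → x ≡ y → (x ≡ᵇ y) ≡ true
≡⇒≡ᵇ-true {zero}  refl = refl
≡⇒≡ᵇ-true {suc x} refl = ≡⇒≡ᵇ-true {x} refl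

∈ᵇ-lookup : ∀ x (xs : Vec ℕ m) i → lookup xs i ≡ x → (x ∈ᵇ toList xs) ≡ true
∈ᵇ-lookup x (y ∷ xs) zero    e rewrite ≡⇒≡ᵇ-true (sym e) = refl
∈ᵇ-lookup x (y ∷ xs) (suc i) e rewrite ∈ᵇ-lookup x xs i e with x ≡ᵇ y
... | true  = refl
... | false = refl

distinct-elim : (xs : Vec ℕ m) → distinct xs ≡ true → ∀ i j → lookup xs i ≡ lookup xs j → i ≡ j
distinct-elim (x ∷ xs) h zero    zero    e = refl
distinct-elim (x ∷ xs) h zero    (suc j) e =
  contradiction (trans (sym (∈ᵇ-lookup x xs j (sym e))) (not-true (proj₁ (∧-elim {not (x ∈ᵇ toList xs)} h)))) true≢false
distinct-elim (x ∷ xs) h (suc i) zero    e =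
  contradiction (trans (sym (∈ᵇ-lookup x xs i e)) (not-true (proj₁ (∧-elim {not (x ∈ᵇ toList xs)} h)))) true≢false
distinct-elim (x ∷ xs) h (suc i) (suc j) e = cong suc (distinct-elim xs (proj₂ (∧-elim {not (x ∈ᵇ toList xs)} h)) i j e)

allᵇ-not : {p : Fin n → Bool} → not (allᵇ p) ≡ true → ∃ λ i → p i ≡ false
allᵇ-not {suc n} {p} h with p zero in eq
... | false = zero , eq
... | true with allᵇ-not {n} {p ∘ suc} h
...   | i , e = suc i , e

isNontrivialEndomorphism : Tri n → Vec (Fin n) n → Bool
isNontrivialEndomorphism T xs = not (allᵇ λ i → lookup xs i == i) ∧ triPreserved (triAdj T) T xs

isNontrivialEndomorphism-elim : (T : Tri n) (xs : Vec (Fin n) n) → isNontrivialEndomorphism T xs ≡ true →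
  NontrivialEndomorphism (triAdj T) (lookup xs)
isNontrivialEndomorphism-elim T xs h with ∧-elim {not (allᵇ λ i → lookup xs i == i)} h
... | moved , preserved with allᵇ-not moved
...   | i , e = triPreserved-elim (triAdj-sym T) T xs preserved , i , λ eq → true≢false (trans (sym (trans (cong (_== i) eq) (==-refl i))) e)

findAutomorphism : Tri n → Bool
findAutomorphism T = search true T (replicate _ (candidates T)) []
  (λ cs → isNontrivialEndomorphism T (Vec.map vertex cs) ∧ distinct (Vec.map (toℕ ∘ vertex) cs))

findAutomorphism-sound : (T : Tri n) → findAutomorphism T ≡ true →
  ∃ λ f → Inj f × NontrivialEndomorphism (triAdj T) f
findAutomorphism-sound T h with search-elim true T _ [] h
... | cs , hc with ∧-elim {isNontrivialEndomorphism T (Vec.map vertex cs)} hc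
...   | he , hd = lookup (Vec.map vertex cs) ,
  (λ u v e → distinct-elim (Vec.map (toℕ ∘ vertex) cs) hd u v (trans (labels u) (trans (cong toℕ e) (sym (labels v))))) ,
  isNontrivialEndomorphism-elim T _ he
  where
  labels : ∀ u → lookup (Vec.map (toℕ ∘ vertex) cs) u ≡ toℕ (lookup (Vec.map vertex cs) u)
  labels u = trans (lookup-map u (toℕ ∘ vertex) cs) (cong toℕ (sym (lookup-map u vertex cs)))

-- The three vertices serve as colours. Without a triangle the list is empty, the colouring search
-- fails at once, and the automorphism search decides.
triangle : List (Candidate n) → List (Candidate n)
triangle []       = []
triangle (c ∷ cs) = case pairs (filterᵇ (λ c′ → label c′ ∈ᵇ neighbours c) cs) of λ where
    []       → triangle cs
    (x ∷ xs) → c ∷ x ∷ xs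
  where
  pairs : List (Candidate _) → List (Candidate _)
  pairs []       = []
  pairs (x ∷ xs) = case filterᵇ (λ c′ → label c′ ∈ᵇ neighbours x) xs of λ where
    []      → pairs xs
    (y ∷ _) → x ∷ y ∷ []

-- A cubic graph with a triangle is mapped to the triangle by a 3-colouring, unless it has a component K₄.
findEndomorphism : Tri n → Bool
findEndomorphism T =
  search false T (replicate _ (triangle (candidates T))) [] (λ cs → isNontrivialEndomorphism T (Vec.map vertex cs))
  ∨ findAutomorphism T

findEndomorphism-sound : (T : Tri n) → findEndomorphism T ≡ true →
  ∃ λ f → NontrivialEndomorphism (triAdj T) f
findEndomorphism-sound {n} T h
  with search false T (replicate n (triangle (candidates T))) [] (λ cs → isNontrivialEndomorphism T (Vec.map vertex cs)) in eq
... | true  with search-elim false T _ [] eq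
...   | cs , hc = _ , isNontrivialEndomorphism-elim T _ hc
findEndomorphism-sound T h | false with findAutomorphism-sound T h
...   | f , _ , e = f , e

-- Transport from the enumerated graphs to arbitrary labelled graphs

module _ (G : Graph n) (reg : Regular d G) where

  -- Before any row is chosen all vertices have remaining degree `d` and are interchangeable, hence
  -- the initial 0.
  relabel : ∀ {accept} → enumerate 0 (replicate n d) accept ≡ true →
    ∃₂ λ T π → Inj π × (∀ i j → triAdj T i j ≡ adj G (π i) (π j)) × accept T ≡ true
  relabel h with enumerate-sound 0 (replicate n d) h (adj G) (symmetric G) (irreflex G)
                   (λ i → trans (count-degree G reg i) (sym (lookup-replicate i d)))
                   (λ i j _ _ → trans (lookup-replicate i d) (sym (lookup-replicate j d)))
  ... | π , T , inj , _ , T≡G , acc = T , π , inj , T≡G , acc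

  module _ (T : Tri n) {π : Fin n → Fin n} (π-inj : Inj π) (T≡G : ∀ i j → triAdj T i j ≡ adj G (π i) (π j)) where

    π⁻¹ : Fin n → Fin n
    π⁻¹ v = proj₁ (injective⇒surjective π-inj v)

    ππ⁻¹ : ∀ v → π (π⁻¹ v) ≡ v
    ππ⁻¹ v = proj₂ (injective⇒surjective π-inj v)

    conjugate : (Fin n → Fin n) → Fin n → Fin n
    conjugate f = π ∘ f ∘ π⁻¹

    conjugate-inj : ∀ {f} → Inj f → Inj (conjugate f)
    conjugate-inj inj u v e = trans (sym (ππ⁻¹ u)) (trans (cong π (inj _ _ (π-inj _ _ e))) (ππ⁻¹ v))

    conjugate-endo : ∀ {f} → NontrivialEndomorphism (triAdj T) f → NontrivialEndomorphism (adj G) (conjugate f)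
    conjugate-endo {f} (pres , i , fi≢i) =
      (λ u v uv → trans (sym (T≡G _ _)) (pres _ _ (trans (T≡G _ _) (trans (cong₂ (adj G) (ππ⁻¹ u) (ππ⁻¹ v)) uv)))) ,
      π i , λ e → fi≢i (π-inj _ _ (trans (cong (π ∘ f) (sym (π-inj _ _ (ππ⁻¹ (π i))))) e))

automorphism-by-enumeration : ∀ n d → enumerate 0 (replicate n d) findAutomorphism ≡ true →
  (G : Graph n) → Regular d G → ∃ λ f → Inj f × NontrivialEndomorphism (adj G) f
automorphism-by-enumeration n d h G reg with relabel G reg h
... | T , π , π-inj , T≡G , acc with findAutomorphism-sound T acc
...   | f , inj , nontrivial = conjugate G reg T π-inj T≡G f , conjugate-inj G reg T π-inj T≡G inj , conjugate-endo G reg T π-inj T≡G nontrivial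

endomorphism-by-enumeration : ∀ n d → enumerate 0 (replicate n d) findEndomorphism ≡ true →
  (G : Graph n) → Regular d G → ∃ λ f → NontrivialEndomorphism (adj G) f
endomorphism-by-enumeration n d h G reg with relabel G reg h
... | T , π , π-inj , T≡G , acc with findEndomorphism-sound T acc
...   | f , nontrivial = conjugate G reg T π-inj T≡G f , conjugate-endo G reg T π-inj T≡G nontrivial

-- Graphs given by lists of neighbours

length-⊆ : {A : Set} {xs ys : List A} → Unique xs → (∀ {x} → x ∈ xs → x ∈ ys) → length xs ≤ length ys
length-⊆ {xs = []}     _             xs⊆ys = z≤n
length-⊆ {xs = x ∷ xs} (x∉xs ∷ uniq) xs⊆ys with ∈-∃++ (xs⊆ys (here refl))
... | as , bs , refl = begin
  suc (length xs)              ≤⟨ s≤s (length-⊆ uniq rest) ⟩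
  suc (length (as ++ bs))      ≡⟨ cong suc (length-++ as) ⟩
  suc (length as + length bs)  ≡⟨ sym (+-suc (length as) (length bs)) ⟩
  length as + suc (length bs)  ≡⟨ sym (length-++ as) ⟩
  length (as ++ x ∷ bs)        ∎
  where
  open ≤-Reasoning
  rest : ∀ {z} → z ∈ xs → z ∈ as ++ bs
  rest z∈xs with ∈-++⁻ as (xs⊆ys (there z∈xs))
  ... | inj₁ z∈as         = ∈-++⁺ˡ z∈as
  ... | inj₂ (there z∈bs) = ∈-++⁺ʳ as z∈bs
  ... | inj₂ (here refl)  = contradiction refl (All.lookup x∉xs z∈xs)

allᴸ : {A : Set} → (A → Bool) → List A → Bool
allᴸ p []       = true
allᴸ p (x ∷ xs) = p x ∧ allᴸ p xs

allᴸ-elim : {A : Set} {p : A → Bool} {xs : List A} → allᴸ p xs ≡ true → ∀ {x} → x ∈ xs → p x ≡ true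
allᴸ-elim h (here refl) = proj₁ (∧-elim h)
allᴸ-elim {p = p} {y ∷ _} h (there i) = allᴸ-elim (proj₂ (∧-elim {p y} h)) i

-- The families live on a structured vertex type. Neighbour lists over it are turned into a graph on
-- `Fin n`, and each hypothesis of `complement-rigid` is reduced to a statement about the lists.
module Presentation {V : Set} {n : ℕ} (encode : V → Fin n) (decode : Fin n → V)
  (decode-encode : ∀ x → decode (encode x) ≡ x) (encode-decode : ∀ i → encode (decode i) ≡ i)
  (_≟_ : DecidableEquality V) (nb : V → List V) {k : ℕ}
  (nb-sym : ∀ x y → y ∈ nb x → x ∈ nb y)
  (nb-unique : ∀ x → Unique (nb x))
  (nb-irrefl : ∀ x → x ∉ nb x)
  (nb-length : ∀ x → length (nb x) ≡ suc k)
  where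

  _∈?_ : ∀ x xs → Dec (x ∈ xs)
  x ∈? xs = any? (x ≟_) xs

  does-⇔ : {A B : Set} (a? : Dec A) (b? : Dec B) → (A → B) → (B → A) → does a? ≡ does b?
  does-⇔ (yes a) b? f g = sym (dec-true b? (f a))
  does-⇔ (no ¬a) b? f g = sym (dec-false b? (¬a ∘ g))

  H : Graph n
  H .adj u v = does (decode v ∈? nb (decode u))
  H .symmetric u v = does-⇔ (_ ∈? _) (_ ∈? _) (nb-sym _ _) (nb-sym _ _)
  H .irreflex v = dec-false (_ ∈? _) (nb-irrefl _)

  adj⇒∈ : ∀ {u v} → adj H u v ≡ true → decode v ∈ nb (decode u)
  adj⇒∈ {u} {v} h = does-true (decode v ∈? nb (decode u)) h

  ∈⇒adj : ∀ {x y} → y ∈ nb x → adj H (encode x) (encode y) ≡ true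
  ∈⇒adj {x} {y} y∈ = dec-true (_ ∈? _) (subst₂ (λ a b → a ∈ nb b) (sym (decode-encode y)) (sym (decode-encode x)) y∈)

  count-∈ : (xs : List V) → Unique xs → count (λ i → does (decode i ∈? xs)) ≡ length xs
  count-∈ []       _             = count-false {n} (λ _ → refl)
  count-∈ (x ∷ xs) (x∉xs ∷ uniq) = begin
    count (λ i → does (decode i ∈? (x ∷ xs)))                           ≡⟨ sum-cong-≗ split ⟩
    sum (λ i → bit (i == encode x) + bit (does (decode i ∈? xs)))       ≡⟨ ∑-distrib-+ (λ i → bit (i == encode x)) _ ⟩
    count (_== encode x) + count (λ i → does (decode i ∈? xs))          ≡⟨ cong₂ _+_ (count-== (encode x)) (count-∈ xs uniq) ⟩
    suc (length xs) ∎
    where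
    open ≡-Reasoning
    split : ∀ i → bit (does (decode i ∈? (x ∷ xs))) ≡ bit (i == encode x) + bit (does (decode i ∈? xs))
    split i with decode i ≟ x
    ... | yes refl rewrite encode-decode i | ==-refl i
                         | dec-false (decode i ∈? xs) (λ ∈xs → All.lookup x∉xs ∈xs refl) = refl
    ... | no ¬e rewrite ==-≢ {u = i} {encode x} (λ e → ¬e (trans (cong decode e) (decode-encode x))) = refl

  H-regular : Regular (suc k) H
  H-regular v = trans (degree≡count H v) (trans (count-∈ (nb (decode v)) (nb-unique _)) (nb-length _))

  module _ (triangleFreeⱽ : ∀ x y z → y ∈ nb x → z ∈ nb y → z ∈ nb x → ⊥) where
    H-triangleFree : TriangleFree H
    H-triangleFree u v w uv vw uw = triangleFreeⱽ _ _ _ (adj⇒∈ uv) (adj⇒∈ {v} vw) (adj⇒∈ {u} uw)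

  Hom : (V → V) → Set
  Hom f = ∀ {x y} → y ∈ nb x → f y ∈ nb (f x)

  module _ (asymmetricⱽ : (f g : V → V) → (∀ x → f (g x) ≡ x) → (∀ x → g (f x) ≡ x) → Hom f → Hom g → ∀ x → f x ≡ x) where

    H-asymmetric : Asymmetric H
    H-asymmetric f inj endo v = trans (sym (encode-decode (f v))) (trans (cong encode fixed) (encode-decode v))
      where
      f⁻¹ : Fin n → Fin n
      f⁻¹ = proj₁ ∘ injective⇒surjective inj
      ff⁻¹ : ∀ v → f (f⁻¹ v) ≡ v
      ff⁻¹ = proj₂ ∘ injective⇒surjective inj
      f⁻¹f : ∀ v → f⁻¹ (f v) ≡ v
      f⁻¹f v = inj _ _ (ff⁻¹ (f v))
      fⱽ gⱽ : V → V
      fⱽ = decode ∘ f ∘ encode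
      gⱽ = decode ∘ f⁻¹ ∘ encode
      lift-hom : (h : Fin n → Fin n) → IsEndomorphism H h → Hom (decode ∘ h ∘ encode)
      lift-hom h h-endo y∈ = adj⇒∈ (h-endo _ _ (∈⇒adj y∈))
      f⁻¹-endo : IsEndomorphism H f⁻¹
      f⁻¹-endo u v uv = trans (sym (injective-endo-reflects H H-regular f inj endo (f⁻¹ u) (f⁻¹ v)))
        (trans (cong₂ (adj H) (ff⁻¹ u) (ff⁻¹ v)) uv)
      fixed : decode (f v) ≡ decode v
      fixed = trans (cong (decode ∘ f) (sym (encode-decode v))) (asymmetricⱽ fⱽ gⱽ
        (λ x → trans (cong (decode ∘ f) (encode-decode _)) (trans (cong decode (ff⁻¹ _)) (decode-encode x)))
        (λ x → trans (cong (decode ∘ f⁻¹) (encode-decode _)) (trans (cong decode (f⁻¹f _)) (decode-encode x)))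
        (lift-hom f endo) (lift-hom f⁻¹ f⁻¹-endo) (decode v))

  module _ (unbalancedⱽ : (c : V → ℕ) → (∀ {x y} → y ∈ nb x → c x + c y ≡ 2) → ∀ x → c x ≡ 1) where

    H-unbalanced : Unbalanced H
    H-unbalanced c sums v = trans (cong c (sym (encode-decode v)))
      (unbalancedⱽ (c ∘ encode) (λ y∈ → sums _ _ (∈⇒adj y∈)) (decode v))

  -- Every site of the strips below has a twin, but some gadget vertices have none, and automorphisms permute the latter.
  record Twin (s : ℕ) (x : V) : Set where
    constructor twin
    field
      other       : V
      other≢      : other ≢ x
      common      : List V
      unique      : Unique common
      many        : length common ≡ s
      neighbours₁ : All (_∈ nb x) common
      neighbours₂ : All (_∈ nb other) common

  twin-image : ∀ {s x} (f g : V → V) → (∀ x → g (f x) ≡ x) → Hom f → Twin s x → Twin s (f x)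
  twin-image {x = x} f g gf hom (twin y y≢x zs uniq many zs⊆x zs⊆y) =
    twin (f y) (λ e → y≢x (inj e)) (List.map f zs) (Unique.map⁺ inj uniq) (trans (length-map f zs) many)
      (All.map⁺ (All.map hom zs⊆x)) (All.map⁺ (All.map hom zs⊆y))
    where
    inj : ∀ {a b} → f a ≡ f b → a ≡ b
    inj e = trans (sym (gf _)) (trans (cong g e) (gf _))

  -- A twin shares a neighbour `z` with `x`, so only neighbours of neighbours of `x` need to be
  -- tried. This keeps the test finite and local whatever the order of the graph.
  twinless : ℕ → V → Bool
  twinless s x = allᴸ (λ z → allᴸ (λ y → not (does (y ≟ x)) ⇒ᵇ (length (filter (_∈? nb y) (nb x)) <ᵇ s)) (nb z)) (nb x)

  twinless-sound : ∀ {s x} → twinless (suc s) x ≡ true → ¬ Twin (suc s) x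
  twinless-sound {s} {x} h (twin y y≢x (z ∷ zs) uniq many (z∈x ∷ zs⊆x) (z∈y ∷ zs⊆y)) =
    <⇒≱ (<ᵇ⇒< (length (filter (_∈? nb y) (nb x))) (suc s) (subst T (sym fewer) _))
      (subst (_≤ length (filter (_∈? nb y) (nb x))) many (length-⊆ uniq λ w∈ → ∈-filter⁺ (_∈? nb y) (All.lookup (z∈x ∷ zs⊆x) w∈) (All.lookup (z∈y ∷ zs⊆y) w∈)))
    where
    fewer : (length (filter (_∈? nb y) (nb x)) <ᵇ suc s) ≡ true
    fewer = ⇒ᵇ-elim (allᴸ-elim (allᴸ-elim h z∈x) (nb-sym y z z∈y)) (cong not (dec-false (y ≟ x) y≢x))

  -- The image of `y` is a neighbour of `x`. If it differed from `y` it would be fixed, so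
  -- `f (f y) ≡ f y`, and injectivity gives `f y ≡ y` after all.
  fixes-last : ∀ {x y} (f : V → V) → (∀ {a b} → f a ≡ f b → a ≡ b) → Hom f → f x ≡ x → y ∈ nb x →
    (∀ {z} → z ∈ nb x → z ≢ y → f z ≡ z) → f y ≡ y
  fixes-last {x} {y} f inj hom fx y∈ others with f y ≟ y
  ... | yes e = e
  ... | no ¬e = inj (others (subst (λ w → f y ∈ nb w) fx (hom y∈)) ¬e)

-- A site has s positions of the strip on its left and r on its right, so that pattern matching
-- recognises both ends of the strip.
data Vertex (g m : ℕ) : Set where
  gad  : Fin g → Vertex g m
  site : Bool → (s r : ℕ) → .(s + suc r ≡ m) → Vertex g m

-- The equation `s + suc r ≡ m` determines `r` but is irrelevant; decidability of equality on ℕ lets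
-- `recompute` recover `r ≡ r′` from it.
site-≡ˢ : ∀ {b s s′ r r′} .{p : s + suc r ≡ m} .{p′ : s′ + suc r′ ≡ m} → s ≡ s′ →
  _≡_ {A = Vertex g m} (site b s r p) (site b s′ r′ p′)
site-≡ˢ {m} {g} {b} {s} {r = r} {r′} {p} {p′} refl with recompute (r ℕ.≟ r′) (suc-injective (+-cancelˡ-≡ s _ _ (trans p (sym p′))))
... | refl = refl

site-≡ʳ : ∀ {b s s′ r r′} .{p : s + suc r ≡ m} .{p′ : s′ + suc r′ ≡ m} → r ≡ r′ →
  _≡_ {A = Vertex g m} (site b s r p) (site b s′ r′ p′)
site-≡ʳ {m} {g} {b} {s} {s′} {r} {p = p} {p′} refl =
  site-≡ˢ (recompute (s ℕ.≟ s′) (+-cancelʳ-≡ (suc r) _ _ (trans p (sym p′))))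

_≟ⱽ_ : DecidableEquality (Vertex g m)
gad i         ≟ⱽ gad j             = map′ (cong gad) (λ { refl → refl }) (i Fin.≟ j)
gad i         ≟ⱽ site b s r p      = no λ ()
site b s r p  ≟ⱽ gad i             = no λ ()
site b s r p  ≟ⱽ site b′ s′ r′ p′  = map′ (λ { (refl , e) → site-≡ˢ e }) (λ { refl → refl , refl }) (b Bool.≟ b′ ×-dec s ℕ.≟ s′)

module _ {g m : ℕ} where

  side : Bool → Fin 2
  side false = zero
  side true  = suc zero

  unside : Fin 2 → Bool
  unside zero       = false
  unside (suc zero) = true

  site-bound : ∀ {s r} → s + suc r ≡ m → s < m
  site-bound {s} {r} p = ≤-trans (s≤s (m≤m+n s r)) (≤-reflexive (trans (sym (+-suc s r)) p))

  position : (s r : ℕ) → .(s + suc r ≡ m) → Fin m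
  position s r p = fromℕ< (recompute (s <? m) (site-bound p))

  encode : Vertex g m → Fin (g + m * 2)
  encode (gad i)        = i ↑ˡ (m * 2)
  encode (site b s r p) = g ↑ʳ combine (position s r p) (side b)

  siteAt : Fin m × Fin 2 → Vertex g m
  siteAt (i , b) = site (unside b) (toℕ i) (m ∸ suc (toℕ i)) (trans (+-suc _ _) (m+[n∸m]≡n (Fin.toℕ<n i)))

  decode : Fin (g + m * 2) → Vertex g m
  decode x = [ gad , siteAt ∘ remQuot 2 ]′ (splitAt g x)

  decode-encode : ∀ x → decode (encode x) ≡ x
  decode-encode (gad i)        = cong [ gad , siteAt ∘ remQuot 2 ]′ (Fin.splitAt-↑ˡ g i (m * 2))
  decode-encode (site b s r p) =
    trans (cong [ gad , siteAt ∘ remQuot 2 ]′ (Fin.splitAt-↑ʳ g (m * 2) (combine (position s r p) (side b))))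
      (trans (cong siteAt (Fin.remQuot-combine (position s r p) (side b))) (siteAt-position b))
    where
    siteAt-position : ∀ b → siteAt (position s r p , side b) ≡ site b s r p
    siteAt-position false = site-≡ˢ (Fin.toℕ-fromℕ< _)
    siteAt-position true  = site-≡ˢ (Fin.toℕ-fromℕ< _)

  encode-siteAt : ∀ ib → encode (siteAt ib) ≡ g ↑ʳ uncurry combine ib
  encode-siteAt (i , b) = cong (g ↑ʳ_) (cong₂ (combine {m} {2}) (Fin.toℕ-injective (Fin.toℕ-fromℕ< _)) (side-unside b))
    where
    side-unside : ∀ b → side (unside b) ≡ b
    side-unside zero       = refl
    side-unside (suc zero) = refl

  encode-decode : ∀ i → encode (decode i) ≡ i
  encode-decode x with splitAt g x in eq
  ... | inj₁ i = Fin.splitAt⁻¹-↑ˡ eq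
  ... | inj₂ j = trans (encode-siteAt (remQuot 2 j)) (trans (cong (g ↑ʳ_) (Fin.combine-remQuot {m} 2 j)) (Fin.splitAt⁻¹-↑ʳ eq))

-- Strips closed up by a gadget

module Gadget {σ τ m k : ℕ} (nb : Vertex (σ + τ) m → List (Vertex (σ + τ) m))
  (nb-sym : ∀ x y → y ∈ nb x → x ∈ nb y)
  (nb-unique : ∀ x → Unique (nb x))
  (nb-irrefl : ∀ x → x ∉ nb x)
  (nb-length : ∀ x → length (nb x) ≡ suc k)
  where

  open Presentation (encode {σ + τ} {m}) decode decode-encode (encode-decode {σ + τ} {m}) _≟ⱽ_ nb nb-sym nb-unique nb-irrefl nb-length public

  core : Fin σ → Vertex (σ + τ) m
  core i = gad (i ↑ˡ τ)

  isCore : Vertex (σ + τ) m → Bool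
  isCore (gad i)        = [ (λ _ → true) , (λ _ → false) ]′ (splitAt σ i)
  isCore (site _ _ _ _) = false

  isCore-elim : ∀ x → isCore x ≡ true → ∃ λ i → x ≡ core i
  isCore-elim (gad i) h with splitAt σ i in eq
  ... | inj₁ j = j , cong gad (sym (Fin.splitAt⁻¹-↑ˡ eq))

  coreAdj : Fin σ → Fin σ → Bool
  coreAdj i j = does (core j ∈? nb (core i))

  -- What is known about an automorphism restricted to the core: it is injective, preserves edges
  -- and sends twinless vertices to twinless ones.
  coreCompatible : ℕ → Fin σ → Fin σ → Fin σ → Fin σ → Bool
  coreCompatible β i c j e = ((toℕ i <ᵇ β) ⇒ᵇ (toℕ c <ᵇ β)) ∧ preserves-distinct coreAdj i c j e

  -- The first β core vertices are the twinless ones, and the core is their closed neighbourhood.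
  module CoreFixed (β s : ℕ)
    (twinless-core : allᵇ (λ i → (toℕ i <ᵇ β) ⇒ᵇ (twinless (suc s) (core i) ∧ allᴸ isCore (nb (core i)))) ≡ true)
    (core-reached : allᵇ (λ i → (toℕ i <ᵇ β) ∨ not (allᵇ λ b → (toℕ b <ᵇ β) ⇒ᵇ not (coreAdj b i))) ≡ true)
    (core-rigid : forced (coreCompatible β) id ≡ true)
    (twins : ∀ x → (∃ λ i → (toℕ i <ᵇ β) ≡ true × x ≡ core i) ⊎ Twin (suc s) x)
    (f g : Vertex (σ + τ) m → Vertex (σ + τ) m) (fg : ∀ x → f (g x) ≡ x) (gf : ∀ x → g (f x) ≡ x) (f-hom : Hom f) (g-hom : Hom g)
    where

    private
      -- A twin of `g (core i)` would be carried by `f` to a twin of `core i`. This is why the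
      -- inverse `g` is studied first.
      g-twinless : ∀ i → (toℕ i <ᵇ β) ≡ true → ∃ λ j → (toℕ j <ᵇ β) ≡ true × g (core i) ≡ core j
      g-twinless i i<β with twins (g (core i))
      ... | inj₁ h = h
      ... | inj₂ t = contradiction (subst (Twin (suc s)) (fg _) (twin-image f g gf f-hom t))
        (twinless-sound (proj₁ (∧-elim (⇒ᵇ-elim (allᵇ-elim twinless-core i) i<β))))

      -- A core vertex that is not twinless is adjacent to a twinless `b`. Its image is adjacent to
      -- the twinless image of `b`, and all neighbours of twinless vertices lie in the core.
      g-core : ∀ i → ∃ λ j → g (core i) ≡ core j × ((toℕ i <ᵇ β) ⇒ᵇ (toℕ j <ᵇ β)) ≡ true
      g-core i with toℕ i <ᵇ β in eq
      ... | true  = let (j , j<β , e) = g-twinless i eq in j , e , j<β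
      ... | false with allᵇ-not (∨-elim (λ e → true≢false (trans (sym e) eq)) (allᵇ-elim core-reached i))
      ...   | b , hb with toℕ b <ᵇ β in b<β | coreAdj b i in bi
      ...     | true | true with g-twinless b b<β
      ...       | b′ , b′<β , e with isCore-elim (g (core i)) (allᴸ-elim {p = isCore} {xs = nb (core b′)}
                    (proj₂ (∧-elim {twinless (suc s) (core b′)} (⇒ᵇ-elim (allᵇ-elim twinless-core b′) b′<β)))
                    (subst (λ x → g (core i) ∈ nb x) e (g-hom (does-true (core i ∈? nb (core b)) bi))))
      ...         | j , e′ = j , e′ , refl

      h : Fin σ → Fin σ
      h = proj₁ ∘ g-core

      g≡h : ∀ i → g (core i) ≡ core (h i)
      g≡h i = proj₁ (proj₂ (g-core i))

      h-injective : ∀ i j → h i ≡ h j → i ≡ j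
      h-injective i j e = Fin.↑ˡ-injective τ i j (gad-injective (trans (sym (fg _))
          (trans (cong f (trans (g≡h i) (trans (cong core e) (sym (g≡h j))))) (fg _))))
        where
        gad-injective : ∀ {i j : Fin (σ + τ)} → gad {m = m} i ≡ gad j → i ≡ j
        gad-injective refl = refl

      h-compatible : ∀ i j → coreCompatible β i (h i) j (h j) ≡ true
      h-compatible i j = cong₂ _∧_ (proj₂ (proj₂ (g-core i))) (cong₂ _∧_
        (⇒ᵇ-intro (λ e → dec-true (i Fin.≟ j) (h-injective i j (==⇒≡ (h i) (h j) e))))
        (⇒ᵇ-intro (λ ij → dec-true (_ ∈? _)
          (subst₂ (λ x y → y ∈ nb x) (g≡h i) (g≡h j) (g-hom (does-true (core j ∈? nb (core i)) ij))))))

    core-fixed : ∀ i → f (core i) ≡ core i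
    core-fixed i = trans (cong f (sym (trans (g≡h i) (cong core (forced-sound _ id core-rigid h h-compatible i))))) (fg _)

  gadAdj : Fin (σ + τ) → Fin (σ + τ) → Bool
  gadAdj i j = does (gad j ∈? nb (gad i))

  -- The colouring is proper at every site, so a monochromatic edge has both ends in the gadget, and
  -- a finite check is enough for every length of the strip.
  module GadgetTriangleFree (colour : Vertex (σ + τ) m → Bool)
    (site-proper : ∀ b s r .p {y} → y ∈ nb (site b s r p) → colour y ≢ colour (site b s r p))
    (no-triangle : allᵇ (λ i → allᴸ (λ y → does (colour y Bool.≟ colour (gad i)) ⇒ᵇ
                       allᴸ (λ z → not (does (z ∈? nb y))) (nb (gad i))) (nb (gad i))) ≡ true)
    where

    -- Every triangle contains an edge between vertices of the same colour.
    monochromatic : ∀ x y z → colour y ≡ colour x → y ∈ nb x → z ∈ nb y → z ∈ nb x → ⊥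
    monochromatic (site b s r p) y z e xy yz xz = site-proper b s r p xy e
    monochromatic (gad i) y z e xy yz xz = true≢false (trans (sym (dec-true (z ∈? nb y) yz))
      (not-true (allᴸ-elim (⇒ᵇ-elim (allᴸ-elim (allᵇ-elim no-triangle i) xy) (dec-true (_ Bool.≟ _) e)) xz)))

    triangleFree : ∀ x y z → y ∈ nb x → z ∈ nb y → z ∈ nb x → ⊥
    triangleFree x y z xy yz xz with colour x in ex | colour y in ey | colour z in ez
    ... | true  | true  | _     = monochromatic x y z (trans ey (sym ex)) xy yz xz
    ... | false | false | _     = monochromatic x y z (trans ey (sym ex)) xy yz xz
    ... | true  | false | true  = monochromatic x z y (trans ez (sym ex)) xz (nb-sym y z yz) xy
    ... | false | true  | false = monochromatic x z y (trans ez (sym ex)) xz (nb-sym y z yz) xy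
    ... | _     | true  | true  = monochromatic y z x (trans ez (sym ey)) yz (nb-sym x z xz) (nb-sym x y xy)
    ... | _     | false | false = monochromatic y z x (trans ez (sym ey)) yz (nb-sym x z xz) (nb-sym x y xy)

  -- The edges inside the gadget already force the value 1 there. Across an edge the value 1 forces
  -- the value 1, so it spreads along the strip.
  module GadgetUnbalanced
    (gadget-unbalanced : forced (balance gadAdj) (λ _ → suc zero) ≡ true)
    (connected : (P : Vertex (σ + τ) m → Set) → (∀ {x y} → y ∈ nb x → P x → P y) → (∀ i → P (gad i)) → ∀ x → P x)
    where

    unbalanced : (c : Vertex (σ + τ) m → ℕ) → (∀ {x y} → y ∈ nb x → c x + c y ≡ 2) → ∀ x → c x ≡ 1
    unbalanced c sums = connected (λ x → c x ≡ 1)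
      (λ {x} {y} xy cx → suc-injective (trans (cong (_+ c y) (sym cx)) (sums xy)))
      (balance-by-search gadAdj gadget-unbalanced (c ∘ gad) c≤2 (λ i j ij → sums (does-true (gad j ∈? nb (gad i)) ij)))
      where
      neighbour : ∀ {xs : List (Vertex (σ + τ) m)} → length xs ≡ suc k → ∃ (_∈ xs)
      neighbour {x ∷ xs} _ = x , here refl
      c≤2 : ∀ i → c (gad i) ≤ 2
      c≤2 i = subst (c (gad i) ≤_) (sums (proj₂ (neighbour (nb-length (gad i))))) (m≤m+n _ _)

pattern 10F = suc 9F
pattern 11F = suc 10F
pattern 12F = suc 11F
pattern 13F = suc 12F

-- A ladder with sites u s and w s (s < 2 + l), where u s is joined to w (s - 1), w s and w (s + 1),
-- closed up to a ring by a gadget on 12 vertices.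
module Cubic (l : ℕ) where

  V : Set
  V = Vertex 12 (2 + l)

  first last : Bool → V
  first b = site b 0 (suc l) refl
  last  b = site b (suc l) 0 (cong suc (+-comm l 1))

  pattern u = false
  pattern w = true

  -- In a cubic graph two common neighbours mean a 4-cycle, and 0 to 3 are the vertices on no
  -- 4-cycle. The rungs 4-5 and 6-11 prolong the ladder at its two ends, and 7-9-8-10 is a further
  -- 4-cycle. An odd cycle is 0-3-1-4-5.
  gadgetNb : Vec (List V) 12
  gadgetNb =
    (gad 2F  ∷ gad 3F  ∷ gad 5F  ∷ []) ∷
    (gad 3F  ∷ gad 4F  ∷ gad 8F  ∷ []) ∷
    (gad 0F  ∷ gad 6F  ∷ gad 9F  ∷ []) ∷
    (gad 0F  ∷ gad 1F  ∷ gad 7F  ∷ []) ∷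
    (gad 1F  ∷ gad 5F  ∷ first u ∷ []) ∷
    (gad 0F  ∷ gad 4F  ∷ first w ∷ []) ∷
    (gad 2F  ∷ gad 11F ∷ last u  ∷ []) ∷
    (gad 3F  ∷ gad 9F  ∷ gad 10F ∷ []) ∷
    (gad 1F  ∷ gad 9F  ∷ gad 10F ∷ []) ∷
    (gad 2F  ∷ gad 7F  ∷ gad 8F  ∷ []) ∷
    (gad 7F  ∷ gad 8F  ∷ gad 11F ∷ []) ∷
    (gad 6F  ∷ gad 10F ∷ last w  ∷ []) ∷ []

  leftEnd rightEnd : Bool → Fin 12
  leftEnd  u = 4F
  leftEnd  w = 5F
  rightEnd u = 6F
  rightEnd w = 11F

  -- The rails change sides at every step. Up to relabelling this is a plain ladder, but now the
  -- side of a site is a proper colouring.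
  left right : Bool → (s r : ℕ) → .(s + suc r ≡ 2 + l) → V
  left  b zero    r       p = gad (leftEnd b)
  left  b (suc s) r       p = site (not b) s (suc r) (trans (+-suc s (suc r)) p)
  right b s       zero    p = gad (rightEnd b)
  right b s       (suc r) p = site (not b) (suc s) r (trans (sym (+-suc s (suc r))) p)

  nb : V → List V
  nb (gad i)        = lookup gadgetNb i
  nb (site b s r p) = left b s r p ∷ site (not b) s r p ∷ right b s r p ∷ []

  left-sym : ∀ b s r .p → site b s r p ∈ nb (left b s r p)
  left-sym u zero    r p = there (there (here (site-≡ˢ refl)))
  left-sym w zero    r p = there (there (here (site-≡ˢ refl)))
  left-sym u (suc s) r p = there (there (here refl))
  left-sym w (suc s) r p = there (there (here refl))

  right-sym : ∀ b s r .p → site b s r p ∈ nb (right b s r p)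
  right-sym u s zero    p = there (there (here (site-≡ʳ refl)))
  right-sym w s zero    p = there (there (here (site-≡ʳ refl)))
  right-sym u s (suc r) p = here refl
  right-sym w s (suc r) p = here refl

  listedBy : V → V → Bool
  listedBy x y = does (any? (x ≟ⱽ_) (nb y))

  gadget-sym : allᵇ (λ i → allᴸ (listedBy (gad i)) (nb (gad i))) ≡ true
  -- Only gadget vertices are looked up, and these are told apart from sites by their constructor,
  -- so the check reduces with `l` a variable.
  gadget-sym = refl

  nb-sym : ∀ x y → y ∈ nb x → x ∈ nb y
  nb-sym (gad i)        y y∈ = does-true (any? (gad i ≟ⱽ_) (nb y))
    (allᴸ-elim (allᵇ-elim {p = λ i → allᴸ (listedBy (gad i)) (nb (gad i))} gadget-sym i) y∈)
  nb-sym (site b s r p) y (here refl)                 = left-sym b s r p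
  nb-sym (site u s r p) y (there (here refl))         = there (here refl)
  nb-sym (site w s r p) y (there (here refl))         = there (here refl)
  nb-sym (site b s r p) y (there (there (here refl))) = right-sym b s r p

  nb-unique : ∀ x → Unique (nb x)
  nb-unique (gad 0F)  = ((λ ()) ∷ (λ ()) ∷ []) ∷ ((λ ()) ∷ []) ∷ [] ∷ []
  nb-unique (gad 1F)  = ((λ ()) ∷ (λ ()) ∷ []) ∷ ((λ ()) ∷ []) ∷ [] ∷ []
  nb-unique (gad 2F)  = ((λ ()) ∷ (λ ()) ∷ []) ∷ ((λ ()) ∷ []) ∷ [] ∷ []
  nb-unique (gad 3F)  = ((λ ()) ∷ (λ ()) ∷ []) ∷ ((λ ()) ∷ []) ∷ [] ∷ []
  nb-unique (gad 4F)  = ((λ ()) ∷ (λ ()) ∷ []) ∷ ((λ ()) ∷ []) ∷ [] ∷ []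
  nb-unique (gad 5F)  = ((λ ()) ∷ (λ ()) ∷ []) ∷ ((λ ()) ∷ []) ∷ [] ∷ []
  nb-unique (gad 6F)  = ((λ ()) ∷ (λ ()) ∷ []) ∷ ((λ ()) ∷ []) ∷ [] ∷ []
  nb-unique (gad 7F)  = ((λ ()) ∷ (λ ()) ∷ []) ∷ ((λ ()) ∷ []) ∷ [] ∷ []
  nb-unique (gad 8F)  = ((λ ()) ∷ (λ ()) ∷ []) ∷ ((λ ()) ∷ []) ∷ [] ∷ []
  nb-unique (gad 9F)  = ((λ ()) ∷ (λ ()) ∷ []) ∷ ((λ ()) ∷ []) ∷ [] ∷ []
  nb-unique (gad 10F) = ((λ ()) ∷ (λ ()) ∷ []) ∷ ((λ ()) ∷ []) ∷ [] ∷ []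
  nb-unique (gad 11F) = ((λ ()) ∷ (λ ()) ∷ []) ∷ ((λ ()) ∷ []) ∷ [] ∷ []
  nb-unique (site u zero    zero    p) = ((λ ()) ∷ (λ ()) ∷ []) ∷ ((λ ()) ∷ []) ∷ [] ∷ []
  nb-unique (site u zero    (suc r) p) = ((λ ()) ∷ (λ ()) ∷ []) ∷ ((λ ()) ∷ []) ∷ [] ∷ []
  nb-unique (site u (suc s) zero    p) = ((λ ()) ∷ (λ ()) ∷ []) ∷ ((λ ()) ∷ []) ∷ [] ∷ []
  nb-unique (site u (suc s) (suc r) p) = ((λ ()) ∷ (λ ()) ∷ []) ∷ ((λ ()) ∷ []) ∷ [] ∷ []
  nb-unique (site w zero    zero    p) = ((λ ()) ∷ (λ ()) ∷ []) ∷ ((λ ()) ∷ []) ∷ [] ∷ []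
  nb-unique (site w zero    (suc r) p) = ((λ ()) ∷ (λ ()) ∷ []) ∷ ((λ ()) ∷ []) ∷ [] ∷ []
  nb-unique (site w (suc s) zero    p) = ((λ ()) ∷ (λ ()) ∷ []) ∷ ((λ ()) ∷ []) ∷ [] ∷ []
  nb-unique (site w (suc s) (suc r) p) = ((λ ()) ∷ (λ ()) ∷ []) ∷ ((λ ()) ∷ []) ∷ [] ∷ []

  -- The only monochromatic edges are 1-4 and 3-7.
  colours : Vec Bool 12
  colours = w ∷ w ∷ u ∷ u ∷ w ∷ u ∷ w ∷ u ∷ u ∷ w ∷ w ∷ u ∷ []

  colour : V → Bool
  colour (gad i)        = lookup colours i
  colour (site b _ _ _) = b

  site-proper : ∀ b s r .p {y} → y ∈ nb (site b s r p) → colour y ≢ b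
  site-proper u zero    r       p (here refl)                 ()
  site-proper w zero    r       p (here refl)                 ()
  site-proper u (suc s) r       p (here refl)                 ()
  site-proper w (suc s) r       p (here refl)                 ()
  site-proper u s       r       p (there (here refl))         ()
  site-proper w s       r       p (there (here refl))         ()
  site-proper u s       zero    p (there (there (here refl))) ()
  site-proper w s       zero    p (there (there (here refl))) ()
  site-proper u s       (suc r) p (there (there (here refl))) ()
  site-proper w s       (suc r) p (there (there (here refl))) ()

  gadget-irrefl : allᵇ (λ i → not (listedBy (gad i) (gad i))) ≡ true
  gadget-irrefl = refl

  nb-irrefl : ∀ x → x ∉ nb x
  nb-irrefl (gad i)        x∈ = true≢false (trans (sym (dec-true (any? (gad i ≟ⱽ_) (nb (gad i))) x∈))
    (not-true (allᵇ-elim {p = λ i → not (listedBy (gad i) (gad i))} gadget-irrefl i)))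
  nb-irrefl (site b s r p) x∈ = site-proper b s r p x∈ refl

  gadget-length : allᵇ (λ i → length (nb (gad i)) ≡ᵇ 3) ≡ true
  gadget-length = refl

  nb-length : ∀ x → length (nb x) ≡ 3
  nb-length (gad i)        = ≡ᵇ⇒≡ _ 3 (subst T (sym (allᵇ-elim {p = λ i → length (nb (gad i)) ≡ᵇ 3} gadget-length i)) _)
  nb-length (site b s r p) = refl

  open Gadget {10} {2} nb nb-sym nb-unique nb-irrefl nb-length
  open GadgetTriangleFree colour site-proper refl

  twins : ∀ x → (∃ λ i → (toℕ i <ᵇ 4) ≡ true × x ≡ core i) ⊎ Twin 2 x
  twins (gad 0F)  = inj₁ (0F , refl , refl)
  twins (gad 1F)  = inj₁ (1F , refl , refl)
  twins (gad 2F)  = inj₁ (2F , refl , refl)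
  twins (gad 3F)  = inj₁ (3F , refl , refl)
  twins (gad 4F)  = inj₂ (twin (first w) (λ ()) (gad 5F ∷ first u ∷ []) (((λ ()) ∷ []) ∷ [] ∷ []) refl
    (there (here refl) ∷ there (there (here refl)) ∷ []) (here refl ∷ there (here refl) ∷ []))
  twins (gad 5F)  = inj₂ (twin (first u) (λ ()) (gad 4F ∷ first w ∷ []) (((λ ()) ∷ []) ∷ [] ∷ []) refl
    (there (here refl) ∷ there (there (here refl)) ∷ []) (here refl ∷ there (here refl) ∷ []))
  twins (gad 6F)  = inj₂ (twin (last w) (λ ()) (gad 11F ∷ last u ∷ []) (((λ ()) ∷ []) ∷ [] ∷ []) refl
    (there (here refl) ∷ there (there (here refl)) ∷ []) (there (there (here refl)) ∷ there (here refl) ∷ []))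
  twins (gad 7F)  = inj₂ (twin (gad 8F) (λ ()) (gad 9F ∷ gad 10F ∷ []) (((λ ()) ∷ []) ∷ [] ∷ []) refl
    (there (here refl) ∷ there (there (here refl)) ∷ []) (there (here refl) ∷ there (there (here refl)) ∷ []))
  twins (gad 8F)  = inj₂ (twin (gad 7F) (λ ()) (gad 9F ∷ gad 10F ∷ []) (((λ ()) ∷ []) ∷ [] ∷ []) refl
    (there (here refl) ∷ there (there (here refl)) ∷ []) (there (here refl) ∷ there (there (here refl)) ∷ []))
  twins (gad 9F)  = inj₂ (twin (gad 10F) (λ ()) (gad 7F ∷ gad 8F ∷ []) (((λ ()) ∷ []) ∷ [] ∷ []) refl
    (there (here refl) ∷ there (there (here refl)) ∷ []) (here refl ∷ there (here refl) ∷ []))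
  twins (gad 10F) = inj₂ (twin (gad 9F) (λ ()) (gad 7F ∷ gad 8F ∷ []) (((λ ()) ∷ []) ∷ [] ∷ []) refl
    (here refl ∷ there (here refl) ∷ []) (there (here refl) ∷ there (there (here refl)) ∷ []))
  twins (gad 11F) = inj₂ (twin (last u) (λ ()) (gad 6F ∷ last w ∷ []) (((λ ()) ∷ []) ∷ [] ∷ []) refl
    (here refl ∷ there (there (here refl)) ∷ []) (there (there (here refl)) ∷ there (here refl) ∷ []))
  -- Successive sites on one side are opposite corners of a 4-cycle; the last position uses its
  -- predecessor instead.
  twins (site b s       (suc r) p) = inj₂ (twin
    (site b (suc s) r (trans (sym (+-suc s (suc r))) p)) (λ ())
    (site (not b) s (suc r) p ∷ site (not b) (suc s) r (trans (sym (+-suc s (suc r))) p) ∷ []) (((λ ()) ∷ []) ∷ [] ∷ []) refl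
    (there (here refl) ∷ there (there (here refl)) ∷ []) (here refl ∷ there (here refl) ∷ []))
  twins (site b (suc s) zero    p) = inj₂ (twin (site b s 1 (trans (+-suc s 1) p)) (λ ())
    (site (not b) s 1 (trans (+-suc s 1) p) ∷ site (not b) (suc s) 0 p ∷ []) (((λ ()) ∷ []) ∷ [] ∷ []) refl
    (here refl ∷ there (here refl) ∷ []) (there (here refl) ∷ there (there (here refl)) ∷ []))
  -- The strip has at least two positions, so no site is at both ends.
  twins (site b zero    zero    p) = Irrelevant.⊥-elim (case p of λ ())

  connected : (P : V → Set) → (∀ {x y} → y ∈ nb x → P x → P y) → (∀ i → P (gad i)) → ∀ x → P x
  connected P step P-gad = λ { (gad i) → P-gad i ; (site b s r p) → P-site b s r p }
    where
    P-site : ∀ b s r .p → P (site b s r p)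
    P-site b zero    r p = step (left-sym b zero r p) (P-gad (leftEnd b))
    P-site b (suc s) r p = step (left-sym b (suc s) r p) (P-site (not b) s (suc r) _)

  module _ (f g : V → V) (fg : ∀ x → f (g x) ≡ x) (gf : ∀ x → g (f x) ≡ x) (f-hom : Hom f) (g-hom : Hom g) where

    open CoreFixed 4 1 refl refl refl twins f g fg gf f-hom g-hom

    f-injective : ∀ {x y} → f x ≡ f y → x ≡ y
    f-injective e = trans (sym (gf _)) (trans (cong g e) (gf _))

    -- The list of a site ends with its neighbour on the right, and the gadget lists used below also
    -- end with the vertex still to be fixed.
    fixes-next : ∀ {x y z₁ z₂} → f x ≡ x → nb x ≡ z₁ ∷ z₂ ∷ y ∷ [] → f z₁ ≡ z₁ → f z₂ ≡ z₂ → f y ≡ y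
    fixes-next {x} {y} fx e fz₁ fz₂ = fixes-last f f-injective f-hom fx (subst (y ∈_) (sym e) (there (there (here refl))))
      λ z∈ z≢y → cases (subst (_ ∈_) e z∈) z≢y
      where
      cases : ∀ {z} → z ∈ _ ∷ _ ∷ y ∷ [] → z ≢ y → f z ≡ z
      cases (here refl)                 _   = fz₁
      cases (there (here refl))         _   = fz₂
      cases (there (there (here refl))) z≢y = contradiction refl z≢y

    gad-fixed : ∀ i → f (gad i) ≡ gad i
    gad-fixed 0F  = core-fixed 0F
    gad-fixed 1F  = core-fixed 1F
    gad-fixed 2F  = core-fixed 2F
    gad-fixed 3F  = core-fixed 3F
    gad-fixed 4F  = core-fixed 4F
    gad-fixed 5F  = core-fixed 5F
    gad-fixed 6F  = core-fixed 6F
    gad-fixed 7F  = core-fixed 7F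
    gad-fixed 8F  = core-fixed 8F
    gad-fixed 9F  = core-fixed 9F
    gad-fixed 10F = fixes-next (core-fixed 7F) refl (core-fixed 3F) (core-fixed 9F)
    gad-fixed 11F = fixes-next (gad-fixed 10F) refl (core-fixed 7F) (core-fixed 8F)

    site-fixed : ∀ b s r .p → f (site b s r p) ≡ site b s r p
    left-fixed : ∀ b s r .p → f (left b s r p) ≡ left b s r p
    left-fixed b zero    r p = gad-fixed (leftEnd b)
    left-fixed b (suc s) r p = site-fixed (not b) s (suc r) _
    site-fixed u zero    r p = subst (λ x → f x ≡ x) (site-≡ˢ refl) (fixes-next (gad-fixed 4F) refl (gad-fixed 1F) (gad-fixed 5F))
    site-fixed w zero    r p = subst (λ x → f x ≡ x) (site-≡ˢ refl) (fixes-next (gad-fixed 5F) refl (gad-fixed 0F) (gad-fixed 4F))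
    site-fixed u (suc s) r p = fixes-next (site-fixed w s (suc r) (trans (+-suc s (suc r)) p)) refl (left-fixed w s (suc r) _) (site-fixed u s (suc r) _)
    site-fixed w (suc s) r p = fixes-next (site-fixed u s (suc r) (trans (+-suc s (suc r)) p)) refl (left-fixed u s (suc r) _) (site-fixed w s (suc r) _)

    all-fixed : ∀ x → f x ≡ x
    all-fixed (gad i)        = gad-fixed i
    all-fixed (site b s r p) = site-fixed b s r p

  open GadgetUnbalanced refl connected

  hasRigidRegular : ∀ {d} → 4 + d ≡ 12 + (2 + l) * 2 → HasRigidRegular d (12 + (2 + l) * 2)
  hasRigidRegular e = complement-hasRigidRegular H H-regular e
    (H-triangleFree triangleFree) (H-unbalanced unbalanced) (H-asymmetric all-fixed)

-- A strip with sites u s and w s (s < 3 + l), where u s is joined to w (s - 2), ..., w (s + 1),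
-- closed up to a ring by a gadget on 14 vertices.
module Quartic (l : ℕ) where

  V : Set
  V = Vertex 14 (3 + l)

  first last : Bool → V
  first b = site b 0 (2 + l) refl
  last  b = site b (2 + l) 0 (cong (2 +_) (+-comm l 1))

  pattern u = false
  pattern w = true

  -- Edges reach back two positions from `u` and ahead two from `w`, so the second `u` site and the
  -- last but one `w` site still meet the gadget.
  second penultimate : V
  second      = site u 1 (suc l) refl
  penultimate = site w (suc l) 1 (cong suc (+-comm l 2))

  -- Vertices 0, 1 and 2 are the twinless ones. The strip is continued to the left by 7, 8 as
  -- `w (-2)`, `w (-1)` and 13 as `u (-1)`, and to the right by 9, 10 as the next two `u` and 12 as
  -- the next `w`. An odd cycle is 0-1-2-5-3.
  gadgetNb : Vec (List V) 14
  gadgetNb =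
    (gad 1F ∷ gad 3F ∷ gad 6F ∷ gad 9F ∷ []) ∷
    (gad 0F ∷ gad 2F ∷ gad 4F ∷ gad 10F ∷ []) ∷
    (gad 1F ∷ gad 5F ∷ gad 7F ∷ gad 8F ∷ []) ∷
    (gad 0F ∷ gad 5F ∷ gad 7F ∷ gad 11F ∷ []) ∷
    (gad 1F ∷ gad 5F ∷ gad 11F ∷ gad 12F ∷ []) ∷
    (gad 2F ∷ gad 3F ∷ gad 4F ∷ gad 6F ∷ []) ∷
    (gad 0F ∷ gad 5F ∷ gad 11F ∷ gad 13F ∷ []) ∷
    (gad 2F ∷ gad 3F ∷ gad 13F ∷ first u ∷ []) ∷
    (gad 2F ∷ gad 13F ∷ first u ∷ second ∷ []) ∷
    (gad 0F ∷ gad 12F ∷ penultimate ∷ last w ∷ []) ∷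
    (gad 1F ∷ gad 11F ∷ gad 12F ∷ last w ∷ []) ∷
    (gad 3F ∷ gad 4F ∷ gad 6F ∷ gad 10F ∷ []) ∷
    (gad 4F ∷ gad 9F ∷ gad 10F ∷ last u ∷ []) ∷
    (gad 6F ∷ gad 7F ∷ gad 8F ∷ first w ∷ []) ∷ []

  left₁ᵘ left₂ᵘ right₁ᵘ left₁ʷ right₁ʷ right₂ʷ : (s r : ℕ) → .(s + suc r ≡ 3 + l) → V
  left₁ᵘ zero          r p = gad 8F
  left₁ᵘ (suc s)       r p = site w s (suc r) (trans (+-suc s (suc r)) p)
  left₂ᵘ zero          r p = gad 7F
  left₂ᵘ (suc zero)    r p = gad 8F
  left₂ᵘ (suc (suc s)) r p = site w s (2 + r) (trans (+-suc s (2 + r)) (cong suc (trans (+-suc s (suc r)) (suc-injective p))))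
  right₁ᵘ s zero          p = gad 12F
  right₁ᵘ s (suc r)       p = site w (suc s) r (trans (sym (+-suc s (suc r))) p)
  left₁ʷ zero          r p = gad 13F
  left₁ʷ (suc s)       r p = site u s (suc r) (trans (+-suc s (suc r)) p)
  right₁ʷ s zero          p = gad 9F
  right₁ʷ s (suc r)       p = site u (suc s) r (trans (sym (+-suc s (suc r))) p)
  right₂ʷ s zero          p = gad 10F
  right₂ʷ s (suc zero)    p = gad 9F
  right₂ʷ s (suc (suc r)) p = site u (2 + s) r (trans (sym (trans (+-suc s (2 + r)) (cong suc (+-suc s (suc r))))) p)

  -- The rightmost neighbour stands first for a `u` site and last for a `w` site, where
  -- `fixes-previous` and `fixes-next` expect it.
  nb : V → List V
  nb (gad i)        = lookup gadgetNb i
  nb (site u s r p) = right₁ᵘ s r p ∷ site w s r p ∷ left₁ᵘ s r p ∷ left₂ᵘ s r p ∷ []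
  nb (site w s r p) = left₁ʷ s r p ∷ site u s r p ∷ right₁ʷ s r p ∷ right₂ʷ s r p ∷ []

  left₁ᵘ-sym : ∀ s r .p → site u s r p ∈ nb (left₁ᵘ s r p)
  left₁ᵘ-sym zero    r p = there (there (here (site-≡ˢ refl)))
  left₁ᵘ-sym (suc s) r p = there (there (here refl))

  left₂ᵘ-sym : ∀ s r .p → site u s r p ∈ nb (left₂ᵘ s r p)
  left₂ᵘ-sym zero          r p = there (there (there (here (site-≡ˢ refl))))
  left₂ᵘ-sym (suc zero)    r p = there (there (there (here (site-≡ˢ refl))))
  left₂ᵘ-sym (suc (suc s)) r p = there (there (there (here refl)))

  right₁ᵘ-sym : ∀ s r .p → site u s r p ∈ nb (right₁ᵘ s r p)
  right₁ᵘ-sym s zero    p = there (there (there (here (site-≡ʳ refl))))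
  right₁ᵘ-sym s (suc r) p = here refl

  left₁ʷ-sym : ∀ s r .p → site w s r p ∈ nb (left₁ʷ s r p)
  left₁ʷ-sym zero    r p = there (there (there (here (site-≡ˢ refl))))
  left₁ʷ-sym (suc s) r p = here refl

  right₁ʷ-sym : ∀ s r .p → site w s r p ∈ nb (right₁ʷ s r p)
  right₁ʷ-sym s zero    p = there (there (there (here (site-≡ʳ refl))))
  right₁ʷ-sym s (suc r) p = there (there (here refl))

  right₂ʷ-sym : ∀ s r .p → site w s r p ∈ nb (right₂ʷ s r p)
  right₂ʷ-sym s zero          p = there (there (there (here (site-≡ʳ refl))))
  right₂ʷ-sym s (suc zero)    p = there (there (here (site-≡ʳ refl)))
  right₂ʷ-sym s (suc (suc r)) p = there (there (there (here refl)))

  listedBy : V → V → Bool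
  listedBy x y = does (any? (x ≟ⱽ_) (nb y))

  gadget-sym : ∀ i → All (λ y → gad i ∈ nb y) (nb (gad i))
  gadget-sym 0F  = here refl ∷ here refl ∷ here refl ∷ here refl ∷ []
  gadget-sym 1F  = here refl ∷ here refl ∷ here refl ∷ here refl ∷ []
  gadget-sym 2F  = there (here refl) ∷ here refl ∷ here refl ∷ here refl ∷ []
  gadget-sym 3F  = there (here refl) ∷ there (here refl) ∷ there (here refl) ∷ here refl ∷ []
  gadget-sym 4F  = there (there (here refl)) ∷ there (there (here refl)) ∷ there (here refl) ∷ here refl ∷ []
  gadget-sym 5F  = there (here refl) ∷ there (here refl) ∷ there (here refl) ∷ there (here refl) ∷ []
  gadget-sym 6F  = there (there (here refl)) ∷ there (there (there (here refl))) ∷ there (there (here refl)) ∷ here refl ∷ []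
  gadget-sym 7F  = there (there (here refl)) ∷ there (there (here refl)) ∷ there (here refl) ∷ there (there (there (here refl))) ∷ []
  gadget-sym 8F  = there (there (there (here refl))) ∷ there (there (here refl)) ∷ there (there (here refl)) ∷ there (there (there (here refl))) ∷ []
  gadget-sym 9F  = there (there (there (here refl))) ∷ there (here refl) ∷ there (there (there (here refl))) ∷ there (there (here refl)) ∷ []
  gadget-sym 10F = there (there (there (here refl))) ∷ there (there (there (here refl))) ∷ there (there (here refl)) ∷ there (there (there (here refl))) ∷ []
  gadget-sym 11F = there (there (there (here refl))) ∷ there (there (here refl)) ∷ there (there (here refl)) ∷ there (here refl) ∷ []
  gadget-sym 12F = there (there (there (here refl))) ∷ there (here refl) ∷ there (there (here refl)) ∷ here refl ∷ []
  gadget-sym 13F = there (there (there (here refl))) ∷ there (there (here refl)) ∷ there (here refl) ∷ here refl ∷ []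

  nb-sym : ∀ x y → y ∈ nb x → x ∈ nb y
  nb-sym (gad i)        y y∈                                  = All.lookup (gadget-sym i) y∈
  nb-sym (site u s r p) y (here refl)                         = right₁ᵘ-sym s r p
  nb-sym (site u s r p) y (there (here refl))                 = there (here refl)
  nb-sym (site u s r p) y (there (there (here refl)))         = left₁ᵘ-sym s r p
  nb-sym (site u s r p) y (there (there (there (here refl)))) = left₂ᵘ-sym s r p
  nb-sym (site w s r p) y (here refl)                         = left₁ʷ-sym s r p
  nb-sym (site w s r p) y (there (here refl))                 = there (here refl)
  nb-sym (site w s r p) y (there (there (here refl)))         = right₁ʷ-sym s r p
  nb-sym (site w s r p) y (there (there (there (here refl)))) = right₂ʷ-sym s r p

  nb-unique : ∀ x → Unique (nb x)
  nb-unique (gad 0F)   = ((λ ()) ∷ (λ ()) ∷ (λ ()) ∷ []) ∷ ((λ ()) ∷ (λ ()) ∷ []) ∷ ((λ ()) ∷ []) ∷ [] ∷ []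
  nb-unique (gad 1F)   = ((λ ()) ∷ (λ ()) ∷ (λ ()) ∷ []) ∷ ((λ ()) ∷ (λ ()) ∷ []) ∷ ((λ ()) ∷ []) ∷ [] ∷ []
  nb-unique (gad 2F)   = ((λ ()) ∷ (λ ()) ∷ (λ ()) ∷ []) ∷ ((λ ()) ∷ (λ ()) ∷ []) ∷ ((λ ()) ∷ []) ∷ [] ∷ []
  nb-unique (gad 3F)   = ((λ ()) ∷ (λ ()) ∷ (λ ()) ∷ []) ∷ ((λ ()) ∷ (λ ()) ∷ []) ∷ ((λ ()) ∷ []) ∷ [] ∷ []
  nb-unique (gad 4F)   = ((λ ()) ∷ (λ ()) ∷ (λ ()) ∷ []) ∷ ((λ ()) ∷ (λ ()) ∷ []) ∷ ((λ ()) ∷ []) ∷ [] ∷ []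
  nb-unique (gad 5F)   = ((λ ()) ∷ (λ ()) ∷ (λ ()) ∷ []) ∷ ((λ ()) ∷ (λ ()) ∷ []) ∷ ((λ ()) ∷ []) ∷ [] ∷ []
  nb-unique (gad 6F)   = ((λ ()) ∷ (λ ()) ∷ (λ ()) ∷ []) ∷ ((λ ()) ∷ (λ ()) ∷ []) ∷ ((λ ()) ∷ []) ∷ [] ∷ []
  nb-unique (gad 7F)   = ((λ ()) ∷ (λ ()) ∷ (λ ()) ∷ []) ∷ ((λ ()) ∷ (λ ()) ∷ []) ∷ ((λ ()) ∷ []) ∷ [] ∷ []
  nb-unique (gad 8F)   = ((λ ()) ∷ (λ ()) ∷ (λ ()) ∷ []) ∷ ((λ ()) ∷ (λ ()) ∷ []) ∷ ((λ ()) ∷ []) ∷ [] ∷ []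
  nb-unique (gad 9F)   = ((λ ()) ∷ (λ ()) ∷ (λ ()) ∷ []) ∷ ((λ ()) ∷ (λ ()) ∷ []) ∷ ((λ ()) ∷ []) ∷ [] ∷ []
  nb-unique (gad 10F)  = ((λ ()) ∷ (λ ()) ∷ (λ ()) ∷ []) ∷ ((λ ()) ∷ (λ ()) ∷ []) ∷ ((λ ()) ∷ []) ∷ [] ∷ []
  nb-unique (gad 11F)  = ((λ ()) ∷ (λ ()) ∷ (λ ()) ∷ []) ∷ ((λ ()) ∷ (λ ()) ∷ []) ∷ ((λ ()) ∷ []) ∷ [] ∷ []
  nb-unique (gad 12F)  = ((λ ()) ∷ (λ ()) ∷ (λ ()) ∷ []) ∷ ((λ ()) ∷ (λ ()) ∷ []) ∷ ((λ ()) ∷ []) ∷ [] ∷ []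
  nb-unique (gad 13F)  = ((λ ()) ∷ (λ ()) ∷ (λ ()) ∷ []) ∷ ((λ ()) ∷ (λ ()) ∷ []) ∷ ((λ ()) ∷ []) ∷ [] ∷ []
  nb-unique (site u zero zero p) = ((λ ()) ∷ (λ ()) ∷ (λ ()) ∷ []) ∷ ((λ ()) ∷ (λ ()) ∷ []) ∷ ((λ ()) ∷ []) ∷ [] ∷ []
  nb-unique (site u zero (suc r) p) = ((λ ()) ∷ (λ ()) ∷ (λ ()) ∷ []) ∷ ((λ ()) ∷ (λ ()) ∷ []) ∷ ((λ ()) ∷ []) ∷ [] ∷ []
  nb-unique (site u (suc zero) zero p) = ((λ ()) ∷ (λ ()) ∷ (λ ()) ∷ []) ∷ ((λ ()) ∷ (λ ()) ∷ []) ∷ ((λ ()) ∷ []) ∷ [] ∷ []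
  nb-unique (site u (suc zero) (suc r) p) = ((λ ()) ∷ (λ ()) ∷ (λ ()) ∷ []) ∷ ((λ ()) ∷ (λ ()) ∷ []) ∷ ((λ ()) ∷ []) ∷ [] ∷ []
  nb-unique (site u (suc (suc s)) zero p) = ((λ ()) ∷ (λ ()) ∷ (λ ()) ∷ []) ∷ ((λ ()) ∷ (λ ()) ∷ []) ∷ ((λ ()) ∷ []) ∷ [] ∷ []
  nb-unique (site u (suc (suc s)) (suc r) p) = ((λ ()) ∷ (λ ()) ∷ (λ ()) ∷ []) ∷ ((λ ()) ∷ (λ ()) ∷ []) ∷ ((λ ()) ∷ []) ∷ [] ∷ []
  nb-unique (site w zero zero p) = ((λ ()) ∷ (λ ()) ∷ (λ ()) ∷ []) ∷ ((λ ()) ∷ (λ ()) ∷ []) ∷ ((λ ()) ∷ []) ∷ [] ∷ []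
  nb-unique (site w zero (suc zero) p) = ((λ ()) ∷ (λ ()) ∷ (λ ()) ∷ []) ∷ ((λ ()) ∷ (λ ()) ∷ []) ∷ ((λ ()) ∷ []) ∷ [] ∷ []
  nb-unique (site w zero (suc (suc r)) p) = ((λ ()) ∷ (λ ()) ∷ (λ ()) ∷ []) ∷ ((λ ()) ∷ (λ ()) ∷ []) ∷ ((λ ()) ∷ []) ∷ [] ∷ []
  nb-unique (site w (suc s) zero p) = ((λ ()) ∷ (λ ()) ∷ (λ ()) ∷ []) ∷ ((λ ()) ∷ (λ ()) ∷ []) ∷ ((λ ()) ∷ []) ∷ [] ∷ []
  nb-unique (site w (suc s) (suc zero) p) = ((λ ()) ∷ (λ ()) ∷ (λ ()) ∷ []) ∷ ((λ ()) ∷ (λ ()) ∷ []) ∷ ((λ ()) ∷ []) ∷ [] ∷ []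
  nb-unique (site w (suc s) (suc (suc r)) p) = ((λ ()) ∷ (λ ()) ∷ (λ ()) ∷ []) ∷ ((λ ()) ∷ (λ ()) ∷ []) ∷ ((λ ()) ∷ []) ∷ [] ∷ []

  -- The only monochromatic edges are 0-1 and 6-13.
  colours : Vec Bool 14
  colours = w ∷ w ∷ u ∷ u ∷ u ∷ w ∷ u ∷ w ∷ w ∷ u ∷ u ∷ w ∷ w ∷ u ∷ []

  colour : V → Bool
  colour (gad i)        = lookup colours i
  colour (site b _ _ _) = b

  site-proper : ∀ b s r .p {y} → y ∈ nb (site b s r p) → colour y ≢ b
  site-proper u s             zero          p (here refl)                         ()
  site-proper u s             (suc r)       p (here refl)                         ()
  site-proper u s             r             p (there (here refl))                 ()
  site-proper u zero          r             p (there (there (here refl)))         ()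
  site-proper u (suc s)       r             p (there (there (here refl)))         ()
  site-proper u zero          r             p (there (there (there (here refl)))) ()
  site-proper u (suc zero)    r             p (there (there (there (here refl)))) ()
  site-proper u (suc (suc s)) r             p (there (there (there (here refl)))) ()
  site-proper w zero          r             p (here refl)                         ()
  site-proper w (suc s)       r             p (here refl)                         ()
  site-proper w s             r             p (there (here refl))                 ()
  site-proper w s             zero          p (there (there (here refl)))         ()
  site-proper w s             (suc r)       p (there (there (here refl)))         ()
  site-proper w s             zero          p (there (there (there (here refl)))) ()
  site-proper w s             (suc zero)    p (there (there (there (here refl)))) ()
  site-proper w s             (suc (suc r)) p (there (there (there (here refl)))) ()

  gadget-irrefl : allᵇ (λ i → not (listedBy (gad i) (gad i))) ≡ true
  gadget-irrefl = refl

  nb-irrefl : ∀ x → x ∉ nb x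
  nb-irrefl (gad i)        x∈ = true≢false (trans (sym (dec-true (any? (gad i ≟ⱽ_) (nb (gad i))) x∈))
    (not-true (allᵇ-elim {p = λ i → not (listedBy (gad i) (gad i))} gadget-irrefl i)))
  nb-irrefl (site b s r p) x∈ = site-proper b s r p x∈ refl

  gadget-length : allᵇ (λ i → length (nb (gad i)) ≡ᵇ 4) ≡ true
  gadget-length = refl

  nb-length : ∀ x → length (nb x) ≡ 4
  nb-length (gad i)        = ≡ᵇ⇒≡ _ 4 (subst T (sym (allᵇ-elim {p = λ i → length (nb (gad i)) ≡ᵇ 4} gadget-length i)) _)
  nb-length (site u s r p) = refl
  nb-length (site w s r p) = refl

  open Gadget {11} {3} nb nb-sym nb-unique nb-irrefl nb-length
  open GadgetTriangleFree colour site-proper refl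

  twins : ∀ x → (∃ λ i → (toℕ i <ᵇ 3) ≡ true × x ≡ core i) ⊎ Twin 3 x
  twins (gad 0F) = inj₁ (0F , refl , refl)
  twins (gad 1F) = inj₁ (1F , refl , refl)
  twins (gad 2F) = inj₁ (2F , refl , refl)
  twins (gad 3F) = inj₂ (twin (gad 6F) (λ ()) (gad 0F ∷ gad 5F ∷ gad 11F ∷ [])
    (((λ ()) ∷ (λ ()) ∷ []) ∷ ((λ ()) ∷ []) ∷ [] ∷ []) refl
    (here refl ∷ there (here refl) ∷ there (there (there (here refl))) ∷ [])
    (here refl ∷ there (here refl) ∷ there (there (here refl)) ∷ []))
  twins (gad 4F) = inj₂ (twin (gad 10F) (λ ()) (gad 1F ∷ gad 11F ∷ gad 12F ∷ [])
    (((λ ()) ∷ (λ ()) ∷ []) ∷ ((λ ()) ∷ []) ∷ [] ∷ []) refl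
    (here refl ∷ there (there (here refl)) ∷ there (there (there (here refl))) ∷ [])
    (here refl ∷ there (here refl) ∷ there (there (here refl)) ∷ []))
  twins (gad 5F) = inj₂ (twin (gad 11F) (λ ()) (gad 3F ∷ gad 4F ∷ gad 6F ∷ [])
    (((λ ()) ∷ (λ ()) ∷ []) ∷ ((λ ()) ∷ []) ∷ [] ∷ []) refl
    (there (here refl) ∷ there (there (here refl)) ∷ there (there (there (here refl))) ∷ [])
    (here refl ∷ there (here refl) ∷ there (there (here refl)) ∷ []))
  twins (gad 6F) = inj₂ (twin (gad 3F) (λ ()) (gad 0F ∷ gad 5F ∷ gad 11F ∷ [])
    (((λ ()) ∷ (λ ()) ∷ []) ∷ ((λ ()) ∷ []) ∷ [] ∷ []) refl
    (here refl ∷ there (here refl) ∷ there (there (here refl)) ∷ [])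
    (here refl ∷ there (here refl) ∷ there (there (there (here refl))) ∷ []))
  twins (gad 7F) = inj₂ (twin (gad 8F) (λ ()) (gad 2F ∷ gad 13F ∷ first u ∷ [])
    (((λ ()) ∷ (λ ()) ∷ []) ∷ ((λ ()) ∷ []) ∷ [] ∷ []) refl
    (here refl ∷ there (there (here refl)) ∷ there (there (there (here refl))) ∷ [])
    (here refl ∷ there (here refl) ∷ there (there (here refl)) ∷ []))
  twins (gad 8F) = inj₂ (twin (gad 7F) (λ ()) (gad 2F ∷ gad 13F ∷ first u ∷ [])
    (((λ ()) ∷ (λ ()) ∷ []) ∷ ((λ ()) ∷ []) ∷ [] ∷ []) refl
    (here refl ∷ there (here refl) ∷ there (there (here refl)) ∷ [])
    (here refl ∷ there (there (here refl)) ∷ there (there (there (here refl))) ∷ []))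
  twins (gad 9F) = inj₂ (twin (last u) (λ ()) (gad 12F ∷ penultimate ∷ last w ∷ [])
    (((λ ()) ∷ (λ ()) ∷ []) ∷ ((λ ()) ∷ []) ∷ [] ∷ []) refl
    (there (here refl) ∷ there (there (here refl)) ∷ there (there (there (here refl))) ∷ [])
    (here refl ∷ there (there (here refl)) ∷ there (here refl) ∷ []))
  twins (gad 10F) = inj₂ (twin (gad 4F) (λ ()) (gad 1F ∷ gad 11F ∷ gad 12F ∷ [])
    (((λ ()) ∷ (λ ()) ∷ []) ∷ ((λ ()) ∷ []) ∷ [] ∷ []) refl
    (here refl ∷ there (here refl) ∷ there (there (here refl)) ∷ [])
    (here refl ∷ there (there (here refl)) ∷ there (there (there (here refl))) ∷ []))
  twins (gad 11F) = inj₂ (twin (gad 5F) (λ ()) (gad 3F ∷ gad 4F ∷ gad 6F ∷ [])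
    (((λ ()) ∷ (λ ()) ∷ []) ∷ ((λ ()) ∷ []) ∷ [] ∷ []) refl
    (here refl ∷ there (here refl) ∷ there (there (here refl)) ∷ [])
    (there (here refl) ∷ there (there (here refl)) ∷ there (there (there (here refl))) ∷ []))
  twins (gad 12F) = inj₂ (twin (last w) (λ ()) (gad 9F ∷ gad 10F ∷ last u ∷ [])
    (((λ ()) ∷ (λ ()) ∷ []) ∷ ((λ ()) ∷ []) ∷ [] ∷ []) refl
    (there (here refl) ∷ there (there (here refl)) ∷ there (there (there (here refl))) ∷ [])
    (there (there (here refl)) ∷ there (there (there (here refl))) ∷ there (here refl) ∷ []))
  twins (gad 13F) = inj₂ (twin (first u) (λ ()) (gad 7F ∷ gad 8F ∷ first w ∷ [])
    (((λ ()) ∷ (λ ()) ∷ []) ∷ ((λ ()) ∷ []) ∷ [] ∷ []) refl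
    (there (here refl) ∷ there (there (here refl)) ∷ there (there (there (here refl))) ∷ [])
    (there (there (there (here refl))) ∷ there (there (here refl)) ∷ there (here refl) ∷ []))
  -- A neighbourhood is a window of four consecutive positions on the other side, with gadget
  -- vertices beyond the ends, so successive sites share three neighbours. Cases are split until the
  -- windows reduce.
  twins (site u zero (suc r) p) = inj₂ (twin
    (site u (suc zero) r (trans (sym (+-suc zero (suc r))) p)) (λ ())
    (left₁ᵘ zero (suc r) p ∷ site w zero (suc r) p ∷ right₁ᵘ zero (suc r) p ∷ [])
    (((λ ()) ∷ (λ ()) ∷ []) ∷ ((λ ()) ∷ []) ∷ [] ∷ []) refl
    (there (there (here refl)) ∷ there (here refl) ∷ here refl ∷ [])
    (there (there (there (here refl))) ∷ there (there (here refl)) ∷ there (here refl) ∷ []))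
  twins (site u (suc s) (suc r) p) = inj₂ (twin
    (site u (suc (suc s)) r (trans (sym (+-suc (suc s) (suc r))) p)) (λ ())
    (left₁ᵘ (suc s) (suc r) p ∷ site w (suc s) (suc r) p ∷ right₁ᵘ (suc s) (suc r) p ∷ [])
    (((λ ()) ∷ (λ ()) ∷ []) ∷ ((λ ()) ∷ []) ∷ [] ∷ []) refl
    (there (there (here refl)) ∷ there (here refl) ∷ here refl ∷ [])
    (there (there (there (here refl))) ∷ there (there (here refl)) ∷ there (here refl) ∷ []))
  twins (site u (suc zero) zero p) = inj₂ (twin
    (site u zero 1 (trans (+-suc zero 1) p)) (λ ())
    (left₂ᵘ (suc zero) zero p ∷ left₁ᵘ (suc zero) zero p ∷ site w (suc zero) zero p ∷ [])
    (((λ ()) ∷ (λ ()) ∷ []) ∷ ((λ ()) ∷ []) ∷ [] ∷ []) refl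
    (there (there (there (here refl))) ∷ there (there (here refl)) ∷ there (here refl) ∷ [])
    (there (there (here refl)) ∷ there (here refl) ∷ here refl ∷ []))
  twins (site u (suc (suc s)) zero p) = inj₂ (twin
    (site u (suc s) 1 (trans (+-suc (suc s) 1) p)) (λ ())
    (left₂ᵘ (suc (suc s)) zero p ∷ left₁ᵘ (suc (suc s)) zero p ∷ site w (suc (suc s)) zero p ∷ [])
    (((λ ()) ∷ (λ ()) ∷ []) ∷ ((λ ()) ∷ []) ∷ [] ∷ []) refl
    (there (there (there (here refl))) ∷ there (there (here refl)) ∷ there (here refl) ∷ [])
    (there (there (here refl)) ∷ there (here refl) ∷ here refl ∷ []))
  twins (site w s (suc zero) p) = inj₂ (twin
    (site w (suc s) zero (trans (sym (+-suc s (suc zero))) p)) (λ ())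
    (site u s (suc zero) p ∷ right₁ʷ s (suc zero) p ∷ right₂ʷ s (suc zero) p ∷ [])
    (((λ ()) ∷ (λ ()) ∷ []) ∷ ((λ ()) ∷ []) ∷ [] ∷ []) refl
    (there (here refl) ∷ there (there (here refl)) ∷ there (there (there (here refl))) ∷ [])
    (here refl ∷ there (here refl) ∷ there (there (here refl)) ∷ []))
  twins (site w s (suc (suc r)) p) = inj₂ (twin
    (site w (suc s) (suc r) (trans (sym (+-suc s (suc (suc r)))) p)) (λ ())
    (site u s (suc (suc r)) p ∷ right₁ʷ s (suc (suc r)) p ∷ right₂ʷ s (suc (suc r)) p ∷ [])
    (((λ ()) ∷ (λ ()) ∷ []) ∷ ((λ ()) ∷ []) ∷ [] ∷ []) refl
    (there (here refl) ∷ there (there (here refl)) ∷ there (there (there (here refl))) ∷ [])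
    (here refl ∷ there (here refl) ∷ there (there (here refl)) ∷ []))
  twins (site w (suc s) zero p) = inj₂ (twin
    (site w s 1 (trans (+-suc s 1) p)) (λ ())
    (left₁ʷ (suc s) zero p ∷ site u (suc s) zero p ∷ right₁ʷ (suc s) zero p ∷ [])
    (((λ ()) ∷ (λ ()) ∷ []) ∷ ((λ ()) ∷ []) ∷ [] ∷ []) refl
    (here refl ∷ there (here refl) ∷ there (there (here refl)) ∷ [])
    (there (here refl) ∷ there (there (here refl)) ∷ there (there (there (here refl))) ∷ []))
  twins (site u zero zero p) = Irrelevant.⊥-elim (case p of λ ())
  twins (site w zero zero p) = Irrelevant.⊥-elim (case p of λ ())

  connected : (P : V → Set) → (∀ {x y} → y ∈ nb x → P x → P y) → (∀ i → P (gad i)) → ∀ x → P x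
  connected P step P-gad = λ { (gad i) → P-gad i ; (site b s r p) → P-site b s r p }
    where
    P-site : ∀ b s r .p → P (site b s r p)
    P-site u zero    r p = step (left₁ᵘ-sym zero r p) (P-gad 8F)
    P-site w zero    r p = step (left₁ʷ-sym zero r p) (P-gad 13F)
    P-site u (suc s) r p = step (left₁ᵘ-sym (suc s) r p) (P-site w s (suc r) _)
    P-site w (suc s) r p = step (left₁ʷ-sym (suc s) r p) (P-site u s (suc r) _)

  module _ (f g : V → V) (fg : ∀ x → f (g x) ≡ x) (gf : ∀ x → g (f x) ≡ x) (f-hom : Hom f) (g-hom : Hom g) where

    open CoreFixed 3 2 refl refl refl twins f g fg gf f-hom g-hom

    f-injective : ∀ {x y} → f x ≡ f y → x ≡ y
    f-injective e = trans (sym (gf _)) (trans (cong g e) (gf _))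

    fixes-next : ∀ {x y z₁ z₂ z₃} → f x ≡ x → nb x ≡ z₁ ∷ z₂ ∷ z₃ ∷ y ∷ [] → f z₁ ≡ z₁ → f z₂ ≡ z₂ → f z₃ ≡ z₃ → f y ≡ y
    fixes-next {x} {y} fx e fz₁ fz₂ fz₃ = fixes-last f f-injective f-hom fx
      (subst (y ∈_) (sym e) (there (there (there (here refl))))) λ z∈ z≢y → cases (subst (_ ∈_) e z∈) z≢y
      where
      cases : ∀ {z} → z ∈ _ ∷ _ ∷ _ ∷ y ∷ [] → z ≢ y → f z ≡ z
      cases (here refl)                         _   = fz₁
      cases (there (here refl))                 _   = fz₂
      cases (there (there (here refl)))         _   = fz₃
      cases (there (there (there (here refl)))) z≢y = contradiction refl z≢y

    fixes-previous : ∀ {x y z₁ z₂ z₃} → f x ≡ x → nb x ≡ y ∷ z₁ ∷ z₂ ∷ z₃ ∷ [] → f z₁ ≡ z₁ → f z₂ ≡ z₂ → f z₃ ≡ z₃ → f y ≡ y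
    fixes-previous {x} {y} fx e fz₁ fz₂ fz₃ = fixes-last f f-injective f-hom fx
      (subst (y ∈_) (sym e) (here refl)) λ z∈ z≢y → cases (subst (_ ∈_) e z∈) z≢y
      where
      cases : ∀ {z} → z ∈ y ∷ _ ∷ _ ∷ _ ∷ [] → z ≢ y → f z ≡ z
      cases (here refl)                         z≢y = contradiction refl z≢y
      cases (there (here refl))                 _   = fz₁
      cases (there (there (here refl)))         _   = fz₂
      cases (there (there (there (here refl)))) _   = fz₃

    gad-fixed : ∀ i → f (gad i) ≡ gad i
    gad-fixed 0F  = core-fixed 0F
    gad-fixed 1F  = core-fixed 1F
    gad-fixed 2F  = core-fixed 2F
    gad-fixed 3F  = core-fixed 3F
    gad-fixed 4F  = core-fixed 4F
    gad-fixed 5F  = core-fixed 5F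
    gad-fixed 6F  = core-fixed 6F
    gad-fixed 7F  = core-fixed 7F
    gad-fixed 8F  = core-fixed 8F
    gad-fixed 9F  = core-fixed 9F
    gad-fixed 10F = core-fixed 10F
    gad-fixed 11F = fixes-next (core-fixed 3F) refl (core-fixed 0F) (core-fixed 5F) (core-fixed 7F)
    gad-fixed 12F = fixes-next (core-fixed 4F) refl (core-fixed 1F) (core-fixed 5F) (gad-fixed 11F)
    gad-fixed 13F = fixes-next (core-fixed 6F) refl (core-fixed 0F) (core-fixed 5F) (gad-fixed 11F)

    -- Induction from the left: `w (s + 1)` is the last unknown neighbour of `u s`, and `u (s + 2)`
    -- that of `w s`.
    u-fixed : ∀ s r .p → f (site u s r p) ≡ site u s r p
    w-fixed : ∀ s r .p → f (site w s r p) ≡ site w s r p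
    left₁ᵘ-fixed : ∀ s r .p → f (left₁ᵘ s r p) ≡ left₁ᵘ s r p
    left₂ᵘ-fixed : ∀ s r .p → f (left₂ᵘ s r p) ≡ left₂ᵘ s r p
    left₁ʷ-fixed : ∀ s r .p → f (left₁ʷ s r p) ≡ left₁ʷ s r p
    left₁ᵘ-fixed zero          r p = gad-fixed 8F
    left₁ᵘ-fixed (suc s)       r p = w-fixed s (suc r) _
    left₂ᵘ-fixed zero          r p = gad-fixed 7F
    left₂ᵘ-fixed (suc zero)    r p = gad-fixed 8F
    left₂ᵘ-fixed (suc (suc s)) r p = w-fixed s (2 + r) _
    left₁ʷ-fixed zero          r p = gad-fixed 13F
    left₁ʷ-fixed (suc s)       r p = u-fixed s (suc r) _
    w-fixed zero          r p = subst (λ x → f x ≡ x) (site-≡ˢ refl)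
      (fixes-next (gad-fixed 13F) refl (gad-fixed 6F) (gad-fixed 7F) (gad-fixed 8F))
    w-fixed (suc s)       r p = fixes-previous (u-fixed s (suc r) (trans (+-suc s (suc r)) p)) refl (w-fixed s (suc r) (trans (+-suc s (suc r)) p)) (left₁ᵘ-fixed s (suc r) (trans (+-suc s (suc r)) p)) (left₂ᵘ-fixed s (suc r) (trans (+-suc s (suc r)) p))
    u-fixed zero          r p = subst (λ x → f x ≡ x) (site-≡ˢ refl)
      (fixes-next (gad-fixed 7F) refl (gad-fixed 2F) (gad-fixed 3F) (gad-fixed 13F))
    u-fixed (suc zero)    r p = subst (λ x → f x ≡ x) (site-≡ˢ refl)
      (fixes-next (gad-fixed 8F) refl (gad-fixed 2F) (gad-fixed 13F) (u-fixed zero (2 + l) refl))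
    u-fixed (suc (suc s)) r p = fixes-next (w-fixed s (2 + r)
      (trans (+-suc s (2 + r)) (cong suc (trans (+-suc s (suc r)) (suc-injective p))))) refl (left₁ʷ-fixed s (2 + r)
      (trans (+-suc s (2 + r)) (cong suc (trans (+-suc s (suc r)) (suc-injective p))))) (u-fixed s (2 + r)
      (trans (+-suc s (2 + r)) (cong suc (trans (+-suc s (suc r)) (suc-injective p))))) (u-fixed (suc s) (suc r) _)

    all-fixed : ∀ x → f x ≡ x
    all-fixed (gad i)        = gad-fixed i
    all-fixed (site u s r p) = u-fixed s r p
    all-fixed (site w s r p) = w-fixed s r p

  open GadgetUnbalanced refl connected

  hasRigidRegular : ∀ {d} → 5 + d ≡ 14 + (3 + l) * 2 → HasRigidRegular d (14 + (3 + l) * 2)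
  hasRigidRegular e = complement-hasRigidRegular H H-regular e
    (H-triangleFree triangleFree) (H-unbalanced unbalanced) (H-asymmetric all-fixed)

-- Small rigid graphs

hasRigidRegular-3-14 : HasRigidRegular 3 14
hasRigidRegular-3-14 = rigid-table table refl refl refl
  where
  table : Vec (List ℕ) 14
  table =
    (1 ∷ 3 ∷ 8 ∷ []) ∷ (0 ∷ 2 ∷ 13 ∷ []) ∷ (1 ∷ 4 ∷ 10 ∷ []) ∷ (0 ∷ 4 ∷ 5 ∷ []) ∷
    (2 ∷ 3 ∷ 6 ∷ []) ∷ (3 ∷ 6 ∷ 7 ∷ []) ∷ (4 ∷ 5 ∷ 9 ∷ []) ∷ (5 ∷ 8 ∷ 11 ∷ []) ∷ (0 ∷ 7 ∷ 9 ∷ []) ∷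
    (6 ∷ 8 ∷ 12 ∷ []) ∷ (2 ∷ 11 ∷ 12 ∷ []) ∷ (7 ∷ 10 ∷ 13 ∷ []) ∷ (9 ∷ 10 ∷ 13 ∷ []) ∷
    (1 ∷ 11 ∷ 12 ∷ []) ∷ []

hasRigidRegular-4-10 : HasRigidRegular 4 10
hasRigidRegular-4-10 = rigid-table table refl refl refl
  where
  table : Vec (List ℕ) 10
  table =
    (1 ∷ 2 ∷ 3 ∷ 4 ∷ []) ∷ (0 ∷ 2 ∷ 5 ∷ 6 ∷ []) ∷ (0 ∷ 1 ∷ 3 ∷ 7 ∷ []) ∷ (0 ∷ 2 ∷ 4 ∷ 8 ∷ []) ∷
    (0 ∷ 3 ∷ 5 ∷ 9 ∷ []) ∷ (1 ∷ 4 ∷ 6 ∷ 7 ∷ []) ∷ (1 ∷ 5 ∷ 8 ∷ 9 ∷ []) ∷ (2 ∷ 5 ∷ 8 ∷ 9 ∷ []) ∷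
    (3 ∷ 6 ∷ 7 ∷ 9 ∷ []) ∷ (4 ∷ 6 ∷ 7 ∷ 8 ∷ []) ∷ []

hasRigidRegular-5-10 : HasRigidRegular 5 10
hasRigidRegular-5-10 = rigid-table table refl refl refl
  where
  table : Vec (List ℕ) 10
  table =
    (1 ∷ 2 ∷ 3 ∷ 4 ∷ 5 ∷ []) ∷ (0 ∷ 2 ∷ 3 ∷ 6 ∷ 9 ∷ []) ∷ (0 ∷ 1 ∷ 4 ∷ 6 ∷ 9 ∷ []) ∷
    (0 ∷ 1 ∷ 5 ∷ 7 ∷ 8 ∷ []) ∷ (0 ∷ 2 ∷ 5 ∷ 6 ∷ 8 ∷ []) ∷ (0 ∷ 3 ∷ 4 ∷ 7 ∷ 9 ∷ []) ∷
    (1 ∷ 2 ∷ 4 ∷ 7 ∷ 8 ∷ []) ∷ (3 ∷ 5 ∷ 6 ∷ 8 ∷ 9 ∷ []) ∷ (3 ∷ 4 ∷ 6 ∷ 7 ∷ 9 ∷ []) ∷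
    (1 ∷ 2 ∷ 5 ∷ 7 ∷ 8 ∷ []) ∷ []

hasRigidRegular-6-11 : HasRigidRegular 6 11
hasRigidRegular-6-11 = rigid-table table refl refl refl
  where
  table : Vec (List ℕ) 11
  table =
    (1 ∷ 2 ∷ 3 ∷ 4 ∷ 5 ∷ 6 ∷ []) ∷ (0 ∷ 2 ∷ 3 ∷ 4 ∷ 8 ∷ 9 ∷ []) ∷ (0 ∷ 1 ∷ 3 ∷ 4 ∷ 5 ∷ 10 ∷ []) ∷
    (0 ∷ 1 ∷ 2 ∷ 5 ∷ 7 ∷ 8 ∷ []) ∷ (0 ∷ 1 ∷ 2 ∷ 6 ∷ 9 ∷ 10 ∷ []) ∷ (0 ∷ 2 ∷ 3 ∷ 6 ∷ 7 ∷ 9 ∷ []) ∷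
    (0 ∷ 4 ∷ 5 ∷ 7 ∷ 8 ∷ 10 ∷ []) ∷ (3 ∷ 5 ∷ 6 ∷ 8 ∷ 9 ∷ 10 ∷ []) ∷ (1 ∷ 3 ∷ 6 ∷ 7 ∷ 9 ∷ 10 ∷ []) ∷
    (1 ∷ 4 ∷ 5 ∷ 7 ∷ 8 ∷ 10 ∷ []) ∷ (2 ∷ 4 ∷ 6 ∷ 7 ∷ 8 ∷ 9 ∷ []) ∷ []

hasRigidRegular-7-12 : HasRigidRegular 7 12
hasRigidRegular-7-12 = rigid-table table refl refl refl
  where
  table : Vec (List ℕ) 12
  table =
    (1 ∷ 2 ∷ 3 ∷ 4 ∷ 5 ∷ 6 ∷ 10 ∷ []) ∷ (0 ∷ 2 ∷ 3 ∷ 6 ∷ 7 ∷ 9 ∷ 11 ∷ []) ∷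
    (0 ∷ 1 ∷ 3 ∷ 4 ∷ 7 ∷ 8 ∷ 10 ∷ []) ∷ (0 ∷ 1 ∷ 2 ∷ 4 ∷ 5 ∷ 6 ∷ 8 ∷ []) ∷
    (0 ∷ 2 ∷ 3 ∷ 5 ∷ 7 ∷ 9 ∷ 11 ∷ []) ∷ (0 ∷ 3 ∷ 4 ∷ 6 ∷ 9 ∷ 10 ∷ 11 ∷ []) ∷
    (0 ∷ 1 ∷ 3 ∷ 5 ∷ 7 ∷ 8 ∷ 11 ∷ []) ∷ (1 ∷ 2 ∷ 4 ∷ 6 ∷ 8 ∷ 9 ∷ 10 ∷ []) ∷
    (2 ∷ 3 ∷ 6 ∷ 7 ∷ 9 ∷ 10 ∷ 11 ∷ []) ∷ (1 ∷ 4 ∷ 5 ∷ 7 ∷ 8 ∷ 10 ∷ 11 ∷ []) ∷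
    (0 ∷ 2 ∷ 5 ∷ 7 ∷ 8 ∷ 9 ∷ 11 ∷ []) ∷ (1 ∷ 4 ∷ 5 ∷ 6 ∷ 8 ∷ 9 ∷ 10 ∷ []) ∷ []

hasRigidRegular-8-12 : HasRigidRegular 8 12
hasRigidRegular-8-12 = rigid-table table refl refl refl
  where
  table : Vec (List ℕ) 12
  table =
    (1 ∷ 2 ∷ 3 ∷ 4 ∷ 5 ∷ 6 ∷ 7 ∷ 11 ∷ []) ∷ (0 ∷ 2 ∷ 3 ∷ 4 ∷ 5 ∷ 6 ∷ 7 ∷ 9 ∷ []) ∷
    (0 ∷ 1 ∷ 3 ∷ 4 ∷ 5 ∷ 8 ∷ 9 ∷ 11 ∷ []) ∷ (0 ∷ 1 ∷ 2 ∷ 4 ∷ 7 ∷ 8 ∷ 9 ∷ 10 ∷ []) ∷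
    (0 ∷ 1 ∷ 2 ∷ 3 ∷ 5 ∷ 6 ∷ 10 ∷ 11 ∷ []) ∷ (0 ∷ 1 ∷ 2 ∷ 4 ∷ 6 ∷ 8 ∷ 9 ∷ 10 ∷ []) ∷
    (0 ∷ 1 ∷ 4 ∷ 5 ∷ 7 ∷ 8 ∷ 10 ∷ 11 ∷ []) ∷ (0 ∷ 1 ∷ 3 ∷ 6 ∷ 8 ∷ 9 ∷ 10 ∷ 11 ∷ []) ∷
    (2 ∷ 3 ∷ 5 ∷ 6 ∷ 7 ∷ 9 ∷ 10 ∷ 11 ∷ []) ∷ (1 ∷ 2 ∷ 3 ∷ 5 ∷ 7 ∷ 8 ∷ 10 ∷ 11 ∷ []) ∷
    (3 ∷ 4 ∷ 5 ∷ 6 ∷ 7 ∷ 8 ∷ 9 ∷ 11 ∷ []) ∷ (0 ∷ 2 ∷ 4 ∷ 6 ∷ 7 ∷ 8 ∷ 9 ∷ 10 ∷ []) ∷ []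

hasRigidRegular-9-14 : HasRigidRegular 9 14
hasRigidRegular-9-14 = rigid-complement-table 3 9 table refl refl refl refl refl
  where
  table : Vec (List ℕ) 14
  table =
    (1 ∷ 3 ∷ 5 ∷ 9 ∷ []) ∷ (0 ∷ 2 ∷ 4 ∷ 10 ∷ []) ∷ (1 ∷ 3 ∷ 6 ∷ 8 ∷ []) ∷ (0 ∷ 2 ∷ 4 ∷ 7 ∷ []) ∷
    (1 ∷ 3 ∷ 5 ∷ 12 ∷ []) ∷ (0 ∷ 4 ∷ 6 ∷ 11 ∷ []) ∷ (2 ∷ 5 ∷ 7 ∷ 13 ∷ []) ∷ (3 ∷ 6 ∷ 8 ∷ 9 ∷ []) ∷
    (2 ∷ 7 ∷ 11 ∷ 13 ∷ []) ∷ (0 ∷ 7 ∷ 10 ∷ 12 ∷ []) ∷ (1 ∷ 9 ∷ 11 ∷ 13 ∷ []) ∷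
    (5 ∷ 8 ∷ 10 ∷ 12 ∷ []) ∷ (4 ∷ 9 ∷ 11 ∷ 13 ∷ []) ∷ (6 ∷ 8 ∷ 10 ∷ 12 ∷ []) ∷ []

hasRigidRegular-10-14 : HasRigidRegular 10 14
hasRigidRegular-10-14 = rigid-complement-table 2 10 table refl refl refl refl refl
  where
  table : Vec (List ℕ) 14
  table =
    (1 ∷ 3 ∷ 5 ∷ []) ∷ (0 ∷ 2 ∷ 13 ∷ []) ∷ (1 ∷ 3 ∷ 8 ∷ []) ∷ (0 ∷ 2 ∷ 4 ∷ []) ∷
    (3 ∷ 5 ∷ 11 ∷ []) ∷ (0 ∷ 4 ∷ 6 ∷ []) ∷ (5 ∷ 7 ∷ 9 ∷ []) ∷ (6 ∷ 8 ∷ 10 ∷ []) ∷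
    (2 ∷ 7 ∷ 12 ∷ []) ∷ (6 ∷ 10 ∷ 11 ∷ []) ∷ (7 ∷ 9 ∷ 13 ∷ []) ∷ (4 ∷ 9 ∷ 12 ∷ []) ∷
    (8 ∷ 11 ∷ 13 ∷ []) ∷ (1 ∷ 10 ∷ 12 ∷ []) ∷ []

hasRigidRegular-11-16 : HasRigidRegular 11 16
hasRigidRegular-11-16 = rigid-complement-table 3 11 table refl refl refl refl refl
  where
  table : Vec (List ℕ) 16
  table =
    (1 ∷ 2 ∷ 6 ∷ 7 ∷ []) ∷ (0 ∷ 3 ∷ 4 ∷ 11 ∷ []) ∷ (0 ∷ 3 ∷ 4 ∷ 5 ∷ []) ∷ (1 ∷ 2 ∷ 8 ∷ 13 ∷ []) ∷
    (1 ∷ 2 ∷ 10 ∷ 12 ∷ []) ∷ (2 ∷ 6 ∷ 7 ∷ 9 ∷ []) ∷ (0 ∷ 5 ∷ 10 ∷ 15 ∷ []) ∷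
    (0 ∷ 5 ∷ 8 ∷ 14 ∷ []) ∷ (3 ∷ 7 ∷ 9 ∷ 15 ∷ []) ∷ (5 ∷ 8 ∷ 10 ∷ 11 ∷ []) ∷
    (4 ∷ 6 ∷ 9 ∷ 13 ∷ []) ∷ (1 ∷ 9 ∷ 12 ∷ 14 ∷ []) ∷ (4 ∷ 11 ∷ 13 ∷ 15 ∷ []) ∷
    (3 ∷ 10 ∷ 12 ∷ 14 ∷ []) ∷ (7 ∷ 11 ∷ 13 ∷ 15 ∷ []) ∷ (6 ∷ 8 ∷ 12 ∷ 14 ∷ []) ∷ []

hasRigidRegular-13-18 : HasRigidRegular 13 18
hasRigidRegular-13-18 = rigid-complement-table 3 13 table refl refl refl refl refl
  where
  table : Vec (List ℕ) 18
  table =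
    (1 ∷ 3 ∷ 6 ∷ 11 ∷ []) ∷ (0 ∷ 2 ∷ 4 ∷ 16 ∷ []) ∷ (1 ∷ 3 ∷ 5 ∷ 9 ∷ []) ∷ (0 ∷ 2 ∷ 4 ∷ 8 ∷ []) ∷
    (1 ∷ 3 ∷ 5 ∷ 7 ∷ []) ∷ (2 ∷ 4 ∷ 6 ∷ 10 ∷ []) ∷ (0 ∷ 5 ∷ 7 ∷ 9 ∷ []) ∷ (4 ∷ 6 ∷ 8 ∷ 17 ∷ []) ∷
    (3 ∷ 7 ∷ 15 ∷ 16 ∷ []) ∷ (2 ∷ 6 ∷ 10 ∷ 12 ∷ []) ∷ (5 ∷ 9 ∷ 11 ∷ 13 ∷ []) ∷
    (0 ∷ 10 ∷ 12 ∷ 14 ∷ []) ∷ (9 ∷ 11 ∷ 13 ∷ 15 ∷ []) ∷ (10 ∷ 12 ∷ 14 ∷ 17 ∷ []) ∷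
    (11 ∷ 13 ∷ 15 ∷ 16 ∷ []) ∷ (8 ∷ 12 ∷ 14 ∷ 17 ∷ []) ∷ (1 ∷ 8 ∷ 14 ∷ 17 ∷ []) ∷
    (7 ∷ 13 ∷ 15 ∷ 16 ∷ []) ∷ []

-- Injectivity is recorded because the result is also applied to the complement of a 4-regular
-- graph, and likewise on 10 vertices for degree 6.
cubic-8 : (G : Graph 8) → Regular 3 G → ∃ λ f → Inj f × NontrivialEndomorphism (adj G) f
cubic-8 = automorphism-by-enumeration 8 3 refl

cubic-10 : (G : Graph 10) → Regular 3 G → ∃ λ f → Inj f × NontrivialEndomorphism (adj G) f
cubic-10 = automorphism-by-enumeration 10 3 refl

-- Automorphisms no longer suffice: the Frucht graph, for instance, is cubic and asymmetric on 12
-- vertices. It contains a triangle, onto which a 3-colouring maps it.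
cubic-12 : (G : Graph 12) → Regular 3 G → ∃ λ f → NontrivialEndomorphism (adj G) f
cubic-12 = endomorphism-by-enumeration 12 3 refl

quartic-9 : (G : Graph 9) → Regular 4 G → ∃ λ f → Inj f × NontrivialEndomorphism (adj G) f
quartic-9 = automorphism-by-enumeration 9 4 refl

-- The smallest orders

halve : ∀ n → ∃ λ j → n ≡ j * 2 ⊎ n ≡ suc (j * 2)
halve zero = 0 , inj₁ refl
halve (suc n) with halve n
... | j , inj₁ refl = j , inj₂ refl
... | j , inj₂ refl = suc j , inj₁ refl

⌈j*2/2⌉≡j : ∀ j → ⌈ j * 2 /2⌉ ≡ j
⌈j*2/2⌉≡j zero    = refl
⌈j*2/2⌉≡j (suc j) = cong suc (⌈j*2/2⌉≡j j)

⌈1+j*2/2⌉≡1+j : ∀ j → ⌈ suc (j * 2) /2⌉ ≡ suc j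
⌈1+j*2/2⌉≡1+j zero    = refl
⌈1+j*2/2⌉≡1+j (suc j) = cong suc (⌈1+j*2/2⌉≡1+j j)

parity-j*2 : ∀ j → parity (j * 2) ≡ 0ℙ
parity-j*2 zero    = refl
parity-j*2 (suc j) = parity-j*2 j

parity-1+j*2 : ∀ j → parity (suc (j * 2)) ≡ 1ℙ
parity-1+j*2 zero    = refl
parity-1+j*2 (suc j) = parity-1+j*2 j

odd-order : parity n ≡ 1ℙ → parity d ≡ 1ℙ → ¬ HasRigidRegular d n
odd-order n-odd d-odd (_ , G , reg , _) = odd-regular G reg n-odd d-odd

-- The bound is `d + 4` for even `d` and `d + 5` for odd `d`; in the odd case the additional order
-- `d + 4` is odd and falls to parity.
order-bound : 3 ≤ d → n < 2 * ⌈ d /2⌉ + 4 → ¬ HasRigidRegular d n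
order-bound {d} {n} 3≤d n< with halve d
... | j , inj₁ refl = rigid-regular-order 3≤d
  (subst (λ x → n < x + 4) (trans (cong (2 *_) (⌈j*2/2⌉≡j j)) (*-comm 2 j)) n<)
... | j , inj₂ refl with m<1+n⇒m<n∨m≡n (subst (n <_) bound n<)
  where
  bound : 2 * ⌈ suc (j * 2) /2⌉ + 4 ≡ suc (suc (j * 2) + 4)
  bound = cong (_+ 4) (trans (cong (2 *_) (⌈1+j*2/2⌉≡1+j j)) (*-comm 2 (suc j)))
...   | inj₁ n<d+4 = rigid-regular-order 3≤d n<d+4
...   | inj₂ refl  = odd-order (trans (cong parity (+-comm (suc (j * 2)) 4)) (parity-1+j*2 j)) (parity-1+j*2 j)

-- The cubic family has order `16 + 2j`, hence degree `12 + 2j` in the complement; the 4-regular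
-- family has order `20 + 2j` and degree `15 + 2j`. Degree 13 lies below the shortest 4-regular
-- strip and needs its own table.
hasRigidRegular-≥12 : ∀ e → HasRigidRegular (12 + e) (2 * ⌈ 12 + e /2⌉ + 4)
hasRigidRegular-≥12 e with halve e
... | j , inj₁ refl = subst (HasRigidRegular (12 + j * 2)) order (Cubic.hasRigidRegular j refl)
  where
  order : 16 + j * 2 ≡ 2 * ⌈ 12 + j * 2 /2⌉ + 4
  order = trans (+-comm 4 (12 + j * 2)) (cong (_+ 4) (sym (trans (cong (λ x → 2 * (6 + x)) (⌈j*2/2⌉≡j j)) (*-comm 2 (6 + j)))))
... | zero , inj₂ refl = hasRigidRegular-13-18
... | suc j , inj₂ refl = subst (HasRigidRegular (15 + j * 2)) order (Quartic.hasRigidRegular j refl)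
  where
  order : 20 + j * 2 ≡ 2 * ⌈ 15 + j * 2 /2⌉ + 4
  order = trans (+-comm 4 (16 + j * 2)) (cong (_+ 4) (sym (trans (cong (λ x → 2 * (7 + x)) (⌈1+j*2/2⌉≡1+j j)) (*-comm 2 (8 + j)))))

nontrivial⇒¬Rigid : (G : Graph n) → (∃ λ f → NontrivialEndomorphism (adj G) f) → ¬ Rigid G
nontrivial⇒¬Rigid G (f , endo , v , fv≢v) rigid = fv≢v (rigid f endo v)

complement-cubic⇒¬Rigid : (∀ (H : Graph n) → Regular 3 H → ∃ λ f → Inj f × NontrivialEndomorphism (adj H) f) →
  4 + d ≡ n → ¬ HasRigidRegular d n
complement-cubic⇒¬Rigid {n} {d} automorphism e (_ , G , reg , rigid)
  with automorphism (complement G) (complement-regular G reg (trans (cong suc (+-comm d 3)) e))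
... | f , inj , endo , moved = automorphism⇒¬Rigid G reg f inj endo moved rigid

order-bound-3 : ∀ n → n < 14 → ¬ HasRigidRegular 3 n
order-bound-3 n n<14 with n <? 8
... | yes n<8 = order-bound ≤-refl n<8
... | no n≮8 with m≤n⇒∃[o]m+o≡n (≮⇒≥ n≮8)
...   | 0 , refl = λ (_ , G , reg , rigid) → case cubic-8 G reg of λ (f , _ , h) → nontrivial⇒¬Rigid G (f , h) rigid
...   | 1 , refl = odd-order refl refl
...   | 2 , refl = λ (_ , G , reg , rigid) → case cubic-10 G reg of λ (f , _ , h) → nontrivial⇒¬Rigid G (f , h) rigid
...   | 3 , refl = odd-order refl refl
...   | 4 , refl = λ (_ , G , reg , rigid) →
  nontrivial⇒¬Rigid G (cubic-12 G reg) rigid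
...   | 5 , refl = odd-order refl refl
...   | suc (suc (suc (suc (suc (suc o))))) , refl = contradiction n<14 (≤⇒≯ (m≤m+n 14 o))

order-bound-4 : ∀ n → n < 10 → ¬ HasRigidRegular 4 n
order-bound-4 n n<10 with n <? 8
... | yes n<8 = order-bound (s≤s (s≤s (s≤s z≤n))) n<8
... | no n≮8 with m≤n⇒∃[o]m+o≡n (≮⇒≥ n≮8)
...   | 0 , refl = complement-cubic⇒¬Rigid cubic-8 refl
...   | 1 , refl = λ (_ , G , reg , rigid) →
  case quartic-9 G reg of λ (f , _ , h) → nontrivial⇒¬Rigid G (f , h) rigid
...   | suc (suc o) , refl = contradiction n<10 (≤⇒≯ (m≤m+n 10 o))

order-bound-6 : ∀ n → n < 11 → ¬ HasRigidRegular 6 n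
order-bound-6 n n<11 with m<1+n⇒m<n∨m≡n n<11
... | inj₁ n<10 = order-bound (s≤s (s≤s (s≤s z≤n))) n<10
... | inj₂ refl = complement-cubic⇒¬Rigid cubic-10 refl

theorem1p1 : ∀ (d : ℕ) → 3 ≤ d → IsNu d (nuValue d)
theorem1p1 3  3≤d = hasRigidRegular-3-14 , order-bound-3
theorem1p1 4  3≤d = hasRigidRegular-4-10 , order-bound-4
theorem1p1 5  3≤d = hasRigidRegular-5-10 , λ n → order-bound 3≤d
theorem1p1 6  3≤d = hasRigidRegular-6-11 , order-bound-6
theorem1p1 7  3≤d = hasRigidRegular-7-12 , λ n → order-bound 3≤d
theorem1p1 8  3≤d = hasRigidRegular-8-12 , λ n → order-bound 3≤d
theorem1p1 9  3≤d = hasRigidRegular-9-14 , λ n → order-bound 3≤d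
theorem1p1 10 3≤d = hasRigidRegular-10-14 , λ n → order-bound 3≤d
theorem1p1 11 3≤d = hasRigidRegular-11-16 , λ n → order-bound 3≤d
theorem1p1 (suc (suc (suc (suc (suc (suc (suc (suc (suc (suc (suc (suc e)))))))))))) 3≤d =
  hasRigidRegular-≥12 e , λ n → order-bound 3≤d
theorem1p1 0 ()
theorem1p1 1 (s≤s ())
theorem1p1 2 (s≤s (s≤s ()))
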